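{- Let $\mathrm{BC}$ be the species of bicolored graphs, $S$ the species of split graphs, and $X$ the species of singletons. Then, in the ring of virtual species, $$\mathrm{BC}=\frac{1}{1-X}\cdot S.$$
   Context: Graphs are finite and simple (the graph with no vertices is allowed). A split graph is a graph whose vertices can be partitioned into two (possibly empty) sets $K$ and $S$ such that $K$ is a clique and $S$ is a stable (independent) set. A bicolored graph is a graph in which each vertex is colored green or red such that no two adjacent vertices have the same color; the colors are not interchangeable, and isomorphisms of bicolored graphs are the graph isomorphisms that preserve color. A (combinatorial) species $F$ is a functor from the category of finite sets with bijections to itself: it assigns to each finite set $I$ a finite set $F[I]$ of structures with label set $I$, and to each bijection $\varphi\colon I\to J$ a bijection $F[\varphi]\colon F[I]\to F[J]$, functorially. Isomorphic species (naturally equivalent functors) are regarded as equal. For a species of (possibly colored) graphs of a certain type, $F[I]$ is the set of such graphs with vertex set $I$, and $F[\varphi]$ replaces each label $i$ by $\varphi(i)$ (keeping colors). Sum: $(F+G)[I]=F[I]\sqcup G[I]$. Product: $(F\cdot G)[I]$ is the set of pairs $(f,g)$ with $f\in F[V]$, $g\in G[W]$, over all ordered partitions $I=V\sqcup W$ (parts may be empty). The species $0$ has no structures; the species $1$ has exactly one structure on the empty set and none on nonempty sets. $X$ is the species of singletons: $X[I]=\{I\}$ if $|I|=1$ and $X[I]=\varnothing$ otherwise. The ring of virtual species consists of formal differences $F^+-F^-$ of species, where $F^+-F^-$ and $G^+-G^-$ are identified when the species $F^++G^-$ and $G^++F^-$ are isomorphic; addition and multiplication extend those of species, with $0$ and $1$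 as identities. A virtual species whose part of size $0$ is $1$ or $-1$ is a unit of this ring; for a unit $F$, $1/F$ denotes its multiplicative inverse. (In particular $1-X$ is a unit.) -}

module Defs where

open import Data.Bool using (Bool; true; false; not)
import Data.Bool.Properties as Bool
open import Axiom.UniquenessOfIdentityProofs using (module Decidable⇒UIP)
open Decidable⇒UIP Bool._≟_ using () renaming (≡-irrelevant to ≡ᵇ-irrelevant)
open import Data.Empty using (⊥; ⊥-elim)
open import Data.List using (List; []; _∷_; map; concatMap; length; upTo; _++_)
open import Data.List.Properties using (length-++)
open import Data.List.Membership.Propositional using (_∈_)
open import Data.List.Membership.Propositional.Properties using (∈-upTo⁺)
open import Data.List.Relation.Unary.Any as Any using (Any; here; there)
import Data.List.Relation.Unary.Any.Properties as Any
import Data.List.Relation.Unary.All as All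
open import Data.List.Relation.Unary.Enumerates.Setoid using (IsEnumeration)
open import Data.Nat using (ℕ; zero; suc; _+_; _≤_; _<_; z≤n; s≤s)
import Data.Nat.Properties as ℕ
open import Data.Product using (Σ-syntax; ∃-syntax; _×_; _,_; proj₁; proj₂)
open import Data.Sum using (inj₁; inj₂)
import Data.Sum as Sum
open import Data.Sum.Relation.Binary.Pointwise using (⊎-setoid; ⊎-decidable; inj₁; inj₂)
open import Data.Unit using (⊤; tt)
open import Function using (_∋_; _∘_; id; Inverse; _↔_; mk↔ₛ′)
open import Function.Construct.Composition using (_↔-∘_)
open import Function.Construct.Identity using (↔-id)
import Function.Construct.Composition as Compose
import Function.Construct.Symmetry as Symmetry
open import Level using (0ℓ)
open import Relation.Binary using (Setoid; Decidable; DecidableEquality)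
open import Relation.Binary.PropositionalEquality
  using (_≡_; _≢_; refl; sym; trans; cong; cong₂; subst; setoid)
open import Relation.Nullary using (Dec; yes; no; ¬_)
open import Relation.Nullary.Decidable using (_×-dec_; _→-dec_; ¬?; map′)

open Setoid using (Carrier)

record IsFinite (S : Setoid 0ℓ 0ℓ) : Set where
  field
    _≟_      : Decidable (Setoid._≈_ S)
    elements : List (Carrier S)
    complete : IsEnumeration S elements

-- Graphs on a label set are functions, for which propositional equality is
-- too fine without function extensionality.  So label sets are types and sets
-- of structures are setoids; both describe the category of finite sets, since
-- a finite setoid is isomorphic to some Fin n.

record FinSet : Set₁ where
  field
    ∣_∣      : Set
    isFinite : IsFinite (setoid ∣_∣)
  open IsFinite isFinite public

open FinSet using (∣_∣)

record FinSetoid : Set₁ where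
  field
    setoid′  : Setoid 0ℓ 0ℓ
    isFinite : IsFinite setoid′
  open Setoid setoid′ public renaming (Carrier to Elem)
  open IsFinite isFinite public

open FinSetoid using (Elem; setoid′)

private
  variable
    I J K : FinSet

all? : ∀ (I : FinSet) {P : ∣ I ∣ → Set} → (∀ i → Dec (P i)) → Dec (∀ i → P i)
all? I P? = map′ (λ ps i → All.lookup ps (FinSet.complete I i))
                  (λ p → All.tabulate (λ {i} _ → p i))
                  (All.all? P? (FinSet.elements I))

decList : {P : Set} → Dec P → List P
decList (yes p) = p ∷ []
decList (no _)  = []

decList⁺ : {P B : Set} {Q : B → Set} {mk : P → B} (P? : Dec P) →
           (∀ p → Q (mk p)) → P → Any Q (map mk (decList P?))
decList⁺ (yes p) q _ = here (q p)
decList⁺ (no ¬p) q p = ⊥-elim (¬p p)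

-- The subset { i | p i ≡ b } of I.
block : (I : FinSet) → (∣ I ∣ → Bool) → Bool → FinSet
block I p b = record
  { ∣_∣ = Σ[ i ∈ ∣ I ∣ ] p i ≡ b
  ; isFinite = record
    { _≟_ = λ (i , e) (j , e′) → map′ (λ { refl → cong (i ,_) (≡ᵇ-irrelevant e e′) })
                                      (cong proj₁) (i I.≟ j)
    ; elements = concatMap (λ i → map (i ,_) (decList (p i Bool.≟ b))) I.elements
    ; complete = λ (i , e) → Any.concatMap⁺ _
        (Any.map (λ { refl → decList⁺ (p i Bool.≟ b)
                               (λ e′ → cong (i ,_) (≡ᵇ-irrelevant e e′)) e })
                 (I.complete i))
    }
  }
  where
  module I = FinSet I

block-≡ : ∀ {A : Set} {p : A → Bool} {b} {x y : Σ[ i ∈ A ] p i ≡ b} →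
          proj₁ x ≡ proj₁ y → x ≡ y
block-≡ {x = i , e} {y = _ , e′} refl = cong (i ,_) (≡ᵇ-irrelevant e e′)

restrict : ∀ {A B : Set} (φ : A ↔ B) {p : A → Bool} {q : B → Bool} →
           (∀ i → p i ≡ q (Inverse.to φ i)) → ∀ b →
           (Σ[ i ∈ A ] p i ≡ b) ↔ (Σ[ j ∈ B ] q j ≡ b)
restrict φ {p} {q} e b = mk↔ₛ′
  (λ (i , h) → φ.to i , trans (sym (e i)) h)
  (λ (j , h) → φ.from j , trans (e (φ.from j)) (trans (cong q (φ.strictlyInverseˡ j)) h))
  (λ (j , _) → block-≡ (φ.strictlyInverseˡ j))
  (λ (i , _) → block-≡ (φ.strictlyInverseʳ i))
  where module φ = Inverse φ

from-≗ : ∀ {A B : Set} (φ ψ : A ↔ B) → (∀ i → Inverse.to φ i ≡ Inverse.to ψ i) →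
         ∀ j → Inverse.from φ j ≡ Inverse.from ψ j
from-≗ φ ψ e j = trans (sym (ψ.strictlyInverseʳ (φ.from j)))
  (cong ψ.from (trans (sym (e (φ.from j))) (φ.strictlyInverseˡ j)))
  where module φ = Inverse φ
        module ψ = Inverse ψ

-- That relabel φ is a bijection follows from the functor laws.  Without eta (and
-- with the constructor inlined below) F ⊕ G, F ⊙ G, ... do not unfold during
-- unification.
record Species : Set₁ where
  no-eta-equality
  constructor species
  field
    _[_]         : FinSet → FinSetoid
    relabel      : ∣ I ∣ ↔ ∣ J ∣ → Elem (_[_] I) → Elem (_[_] J)
    relabel-resp : (φ ψ : ∣ I ∣ ↔ ∣ J ∣) → (∀ i → Inverse.to φ i ≡ Inverse.to ψ i) →
                   ∀ {s t} → FinSetoid._≈_ (_[_] I) s t →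
                   FinSetoid._≈_ (_[_] J) (relabel {I} {J} φ s) (relabel {I} {J} ψ t)
    relabel-id   : ∀ s → FinSetoid._≈_ (_[_] I) (relabel {I} {I} (↔-id ∣ I ∣) s) s
    relabel-∘    : (φ : ∣ I ∣ ↔ ∣ J ∣) (ψ : ∣ J ∣ ↔ ∣ K ∣) → ∀ s →
                   FinSetoid._≈_ (_[_] K) (relabel {I} {K} (ψ ↔-∘ φ) s)
                                          (relabel {J} {K} ψ (relabel {I} {J} φ s))

  private
    module _ {I : FinSet} where open FinSetoid (_[_] I) public using () renaming (refl to ≈-refl; trans to ≈-trans; sym to ≈-sym)

  relabel-id′ : (φ : ∣ I ∣ ↔ ∣ I ∣) → (∀ i → Inverse.to φ i ≡ i) → ∀ s →
                FinSetoid._≈_ (_[_] I) (relabel {I} {I} φ s) s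
  relabel-id′ {I} φ e s =
    ≈-trans {I} (relabel-resp {I} {I} φ (↔-id _) e (≈-refl {I})) (relabel-id {I} s)

  relabel-∘′ : (φ : ∣ I ∣ ↔ ∣ J ∣) (ψ : ∣ J ∣ ↔ ∣ K ∣) (χ : ∣ I ∣ ↔ ∣ K ∣) →
               (∀ i → Inverse.to χ i ≡ Inverse.to ψ (Inverse.to φ i)) → ∀ s →
               FinSetoid._≈_ (_[_] K) (relabel {I} {K} χ s)
                                      (relabel {J} {K} ψ (relabel {I} {J} φ s))
  relabel-∘′ {I} {J} {K} φ ψ χ e s =
    ≈-trans {K} (relabel-resp {I} {K} χ (ψ ↔-∘ φ) e (≈-refl {I}))
                (relabel-∘ {I} {J} {K} φ ψ s)

  relabel-square : ∀ {J′} (φ : ∣ I ∣ ↔ ∣ J ∣) (ψ : ∣ J ∣ ↔ ∣ K ∣)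
                   (φ′ : ∣ I ∣ ↔ ∣ J′ ∣) (ψ′ : ∣ J′ ∣ ↔ ∣ K ∣) →
                   (∀ i → Inverse.to ψ (Inverse.to φ i) ≡ Inverse.to ψ′ (Inverse.to φ′ i)) → ∀ s →
                   FinSetoid._≈_ (_[_] K) (relabel {J} {K} ψ (relabel {I} {J} φ s))
                                          (relabel {J′} {K} ψ′ (relabel {I} {J′} φ′ s))
  relabel-square {I} {J} {K} {J′} φ ψ φ′ ψ′ e s =
    ≈-trans {K} (≈-sym {K} (relabel-∘ {I} {J} {K} φ ψ s))
                (relabel-∘′ {I} {J′} {K} φ′ ψ′ (ψ ↔-∘ φ) e s)

open Species using (_[_])

{-# INLINE species #-}

record _≅_ (F G : Species) : Set₁ where
  private
    module F = Species F
    module G = Species G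
  field
    iso     : ∀ I → Inverse (setoid′ (F [ I ])) (setoid′ (G [ I ]))
    natural : (φ : ∣ I ∣ ↔ ∣ J ∣) → ∀ s →
              FinSetoid._≈_ (G [ J ]) (Inverse.to (iso J) (F.relabel {I} {J} φ s))
                                      (G.relabel {I} {J} φ (Inverse.to (iso I) s))

infix 4 _≅_

-- A proposition, as a finite set with at most one element.
⌊_⌋ : {P : Set} → Dec P → FinSetoid
⌊_⌋ {P} P? = record
  { setoid′ = record { Carrier = P ; _≈_ = λ _ _ → ⊤ ; isEquivalence = _ }
  ; isFinite = record
    { _≟_ = λ _ _ → yes tt
    ; elements = map id (decList P?)
    ; complete = decList⁺ P? (λ _ → tt)
    }
  }

empty? : ∀ I → Dec (¬ ∣ I ∣)
empty? I with FinSet.elements I | FinSet.complete I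
... | []    | all = yes (Any.¬Any[] ∘ all)
... | i ∷ _ | _   = no λ empty → empty i

singleton? : ∀ I → Dec (Σ[ i ∈ ∣ I ∣ ] (∀ j → i ≡ j))
singleton? I with FinSet.elements I | FinSet.complete I
... | []    | all = no (Any.¬Any[] ∘ all ∘ proj₁)
... | i ∷ _ | _   = map′ (i ,_) (λ (_ , h) j → trans (sym (h i)) (h j))
                         (all? I (FinSet._≟_ I i))

𝟘 : Species
𝟘 = record
  { _[_]         = λ _ → ⌊ (Dec ⊥ ∋ no id) ⌋
  ; relabel      = λ _ ()
  ; relabel-resp = λ _ _ _ → id
  ; relabel-id   = λ ()
  ; relabel-∘    = λ _ _ ()
  }

𝟙 : Species
𝟙 = record
  { _[_]         = λ I → ⌊ empty? I ⌋
  ; relabel      = λ φ empty → empty ∘ Inverse.from φ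
  ; relabel-resp = λ _ _ _ → id
  ; relabel-id   = λ _ → tt
  ; relabel-∘    = λ _ _ _ → tt
  }

X : Species
X = record
  { _[_]         = λ I → ⌊ singleton? I ⌋
  ; relabel      = λ φ (i , h) → Inverse.to φ i , λ j →
                     trans (cong (Inverse.to φ) (h (Inverse.from φ j))) (Inverse.strictlyInverseˡ φ j)
  ; relabel-resp = λ _ _ _ → id
  ; relabel-id   = λ _ → tt
  ; relabel-∘    = λ _ _ _ → tt
  }

infixl 6 _⊕_
infixl 7 _⊙_

_⊕_ : Species → Species → Species
F ⊕ G = record
  { _[_]         = λ I → record
    { setoid′  = ⊎-setoid (setoid′ (F [ I ])) (setoid′ (G [ I ]))
    ; isFinite = record
      { _≟_      = ⊎-decidable (FinSetoid._≟_ (F [ I ])) (FinSetoid._≟_ (G [ I ]))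
      ; elements = map inj₁ (FinSetoid.elements (F [ I ])) ++ map inj₂ (FinSetoid.elements (G [ I ]))
      ; complete = λ
        { (inj₁ f) → Any.++⁺ˡ (Any.map⁺ (Any.map inj₁ (FinSetoid.complete (F [ I ]) f)))
        ; (inj₂ g) → Any.++⁺ʳ (map inj₁ (FinSetoid.elements (F [ I ])))
                              (Any.map⁺ (Any.map inj₂ (FinSetoid.complete (G [ I ]) g)))
        }
      }
    }
  ; relabel      = λ {I} {J} φ → Sum.map (F.relabel {I} {J} φ) (G.relabel {I} {J} φ)
  ; relabel-resp = λ {I} {J} φ ψ e → λ
      { (inj₁ f) → inj₁ (F.relabel-resp {I} {J} φ ψ e f)
      ; (inj₂ g) → inj₂ (G.relabel-resp {I} {J} φ ψ e g) }
  ; relabel-id   = λ {I} → λ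
      { (inj₁ f) → inj₁ (F.relabel-id {I} f) ; (inj₂ g) → inj₂ (G.relabel-id {I} g) }
  ; relabel-∘    = λ {I} {J} {K} φ ψ → λ
      { (inj₁ f) → inj₁ (F.relabel-∘ {I} {J} {K} φ ψ f)
      ; (inj₂ g) → inj₂ (G.relabel-∘ {I} {J} {K} φ ψ g) }
  }
  where
  module F = Species F
  module G = Species G

-- Transport of a structure on { i | p i ≡ b } along a pointwise equality p ≗ q.
transport : ∀ F (I : FinSet) {p q : ∣ I ∣ → Bool} (e : ∀ i → p i ≡ q i) b →
            Elem (F [ block I p b ]) → Elem (F [ block I q b ])
transport F I {p} {q} e b =
  Species.relabel F {block I p b} {block I q b} (restrict (↔-id ∣ I ∣) e b)

moveBlock : ∀ F (I J : FinSet) (φ : ∣ I ∣ ↔ ∣ J ∣) (p : ∣ I ∣ → Bool) b →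
            Elem (F [ block I p b ]) → Elem (F [ block J (p ∘ Inverse.from φ) b ])
moveBlock F I J φ p b =
  Species.relabel F {block I p b} {block J (p ∘ Inverse.from φ) b}
    (restrict φ (λ i → cong p (sym (Inverse.strictlyInverseʳ φ i))) b)

module Transport (F : Species) where
  open Species F
  module _ {I : FinSet} where
    open FinSetoid (F [ I ]) public
      using (_≈_) renaming (refl to ≈-refl; trans to ≈-trans; sym to ≈-sym)

  transport-refl : ∀ I {p : ∣ I ∣ → Bool} (e : ∀ i → p i ≡ p i) b f →
                   _≈_ {block I p b} (transport F I e b f) f
  transport-refl I {p} e b f =
    relabel-id′ {block I p b} (restrict (↔-id _) e b) (λ _ → block-≡ refl) f

  transport-sym : ∀ I {p q : ∣ I ∣ → Bool} (e : ∀ i → p i ≡ q i) b {f g} →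
                  _≈_ {block I q b} (transport F I e b f) g →
                  _≈_ {block I p b} (transport F I (sym ∘ e) b g) f
  transport-sym I {p} {q} e b {f} {g} f≈g =
    ≈-trans {block I p b}
      (relabel-resp {block I q b} {block I p b} e⁻¹ e⁻¹ (λ _ → refl) (≈-sym {block I q b} f≈g))
      (≈-trans {block I p b}
        (≈-sym {block I p b} (relabel-∘′ {block I p b} {block I q b} {block I p b}
          (restrict (↔-id _) e b) e⁻¹ (↔-id _) (λ _ → block-≡ refl) f))
        (relabel-id {block I p b} f))
    where e⁻¹ = restrict (↔-id ∣ I ∣) {q} {p} (sym ∘ e) b

  transport-trans : ∀ I {p q r : ∣ I ∣ → Bool} (e : ∀ i → p i ≡ q i) (e′ : ∀ i → q i ≡ r i) b {f g h} →
                    _≈_ {block I q b} (transport F I e b f) g →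
                    _≈_ {block I r b} (transport F I e′ b g) h →
                    _≈_ {block I r b} (transport F I (λ i → trans (e i) (e′ i)) b f) h
  transport-trans I {p} {q} {r} e e′ b {f} f≈g g≈h =
    ≈-trans {block I r b}
      (relabel-∘′ {block I p b} {block I q b} {block I r b}
        (restrict (↔-id _) e b) e₂ (restrict (↔-id _) (λ i → trans (e i) (e′ i)) b) (λ _ → block-≡ refl) f)
      (≈-trans {block I r b}
        (relabel-resp {block I q b} {block I r b} e₂ e₂ (λ _ → refl) f≈g) g≈h)
    where e₂ = restrict (↔-id ∣ I ∣) {q} {r} e′ b

  transport-≡ : ∀ I {p q : ∣ I ∣ → Bool} (e e′ : ∀ i → p i ≡ q i) b f →
                _≈_ {block I q b} (transport F I e b f) (transport F I e′ b f)
  transport-≡ I {p} {q} e e′ b f =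
    relabel-resp {block I p b} {block I q b} (restrict (↔-id _) e b) (restrict (↔-id _) e′ b)
      (λ _ → block-≡ refl) (≈-refl {block I p b})

  moveBlock-resp : ∀ I J (φ ψ : ∣ I ∣ ↔ ∣ J ∣) {p q : ∣ I ∣ → Bool} (e : ∀ i → p i ≡ q i)
                   (e′ : ∀ j → p (Inverse.from φ j) ≡ q (Inverse.from ψ j)) b {f g} →
                   (∀ i → Inverse.to φ i ≡ Inverse.to ψ i) →
                   _≈_ {block I q b} (transport F I e b f) g →
                   _≈_ {block J (q ∘ Inverse.from ψ) b}
                     (transport F J e′ b (moveBlock F I J φ p b f)) (moveBlock F I J ψ q b g)
  moveBlock-resp I J φ ψ {p} {q} e e′ b {f} φ≗ψ f≈g =
    ≈-trans {block J (q ∘ Inverse.from ψ) b}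
      (relabel-square {block I p b} {block J (p ∘ Inverse.from φ) b} {block J (q ∘ Inverse.from ψ) b} {block I q b}
        (restrict φ _ b) (restrict (↔-id _) e′ b) (restrict (↔-id _) e b) ψ′
        (λ (i , _) → block-≡ (φ≗ψ i)) f)
      (relabel-resp {block I q b} {block J (q ∘ Inverse.from ψ) b} ψ′ ψ′ (λ _ → refl) f≈g)
    where ψ′ = restrict ψ {q} {q ∘ Inverse.from ψ} (λ i → cong q (sym (Inverse.strictlyInverseʳ ψ i))) b

  moveBlock-id : ∀ I (p : ∣ I ∣ → Bool) b f →
                 _≈_ {block I p b} (transport F I (λ _ → refl) b (moveBlock F I I (↔-id _) p b f)) f
  moveBlock-id I p b f = ≈-trans {block I p b}
    (transport-refl I (λ _ → refl) b _)
    (relabel-id′ {block I p b} (restrict (↔-id _) _ b) (λ _ → block-≡ refl) f)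

  moveBlock-∘ : ∀ I J K (φ : ∣ I ∣ ↔ ∣ J ∣) (ψ : ∣ J ∣ ↔ ∣ K ∣) (p : ∣ I ∣ → Bool) b f →
                _≈_ {block K (p ∘ Inverse.from φ ∘ Inverse.from ψ) b}
                  (transport F K (λ _ → refl) b (moveBlock F I K (ψ ↔-∘ φ) p b f))
                  (moveBlock F J K ψ (p ∘ Inverse.from φ) b (moveBlock F I J φ p b f))
  moveBlock-∘ I J K φ ψ p b f = ≈-trans {block K _ b}
    (transport-refl K (λ _ → refl) b _)
    (relabel-∘′ {block I p b} {block J _ b} {block K _ b}
      (restrict φ _ b) (restrict ψ _ b) (restrict (ψ ↔-∘ φ) _ b) (λ _ → block-≡ refl) f)

_⇒_ : FinSet → Setoid 0ℓ 0ℓ → Setoid 0ℓ 0ℓ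
I ⇒ A = record
  { Carrier = ∣ I ∣ → Carrier A
  ; _≈_ = λ f g → ∀ i → Setoid._≈_ A (f i) (g i)
  ; isEquivalence = record
    { refl  = λ _ → Setoid.refl A
    ; sym   = λ e i → Setoid.sym A (e i)
    ; trans = λ e e′ i → Setoid.trans A (e i) (e′ i)
    }
  }

⇒-isFinite : ∀ I (A : Setoid 0ℓ 0ℓ) → Carrier A → IsFinite A → IsFinite (I ⇒ A)
⇒-isFinite I A a₀ finA = record
  { _≟_      = λ f g → all? I (λ i → A._≟_ (f i) (g i))
  ; elements = funs I.elements
  ; complete = λ g → Any.map (λ e i → e i (I.complete i)) (funs⁺ g I.elements)
  }
  where
  module I = FinSet I
  module A where
    open Setoid A public
    open IsFinite finA public

  update : ∣ I ∣ → (∣ I ∣ → A.Carrier) → A.Carrier → ∣ I ∣ → A.Carrier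
  update i f a j with j I.≟ i
  ... | yes _ = a
  ... | no  _ = f j

  funs : List ∣ I ∣ → List (∣ I ∣ → A.Carrier)
  funs []       = (λ _ → a₀) ∷ []
  funs (i ∷ is) = concatMap (λ f → map (update i f) A.elements) (funs is)

  update⁺ : ∀ i is {f g a} → g i A.≈ a → (∀ j → j ∈ is → g j A.≈ f j) →
            ∀ j → j ∈ (i ∷ is) → g j A.≈ update i f a j
  update⁺ i is {f} {g} ga gf j j∈ with j I.≟ i
  update⁺ i is {f} {g} ga gf j j∈          | yes refl = ga
  update⁺ i is {f} {g} ga gf j (here j≡i)  | no j≢i   = ⊥-elim (j≢i j≡i)
  update⁺ i is {f} {g} ga gf j (there j∈)  | no _     = gf j j∈

  funs⁺ : ∀ g is → Any (λ f → ∀ j → j ∈ is → g j A.≈ f j) (funs is)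
  funs⁺ g []       = here (λ _ ())
  funs⁺ g (i ∷ is) = Any.concatMap⁺ _
    (Any.map (λ {f} gf → Any.map⁺ (Any.map (λ ga → update⁺ i is {f} {g} ga gf) (A.complete (g i)))) (funs⁺ g is))

Bool-isFinite : IsFinite (setoid Bool)
Bool-isFinite = record
  { _≟_      = Bool._≟_
  ; elements = true ∷ false ∷ []
  ; complete = λ { true → here refl ; false → there (here refl) }
  }

subsets : FinSet → FinSetoid
subsets I = record { setoid′ = I ⇒ setoid Bool ; isFinite = ⇒-isFinite I (setoid Bool) false Bool-isFinite }

-- An ordered partition of I into V = { i | p i ≡ true } and W = { i | p i ≡ false }
-- is encoded by p.
_⊙_ : Species → Species → Species
F ⊙ G = record
  { _[_] = λ I → record
    { setoid′ = record
      { Carrier = Structure I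
      ; _≈_ = Same I
      ; isEquivalence = record
        { refl  = λ {(p , f , g)} → (λ _ → refl) , FT.transport-refl I _ true f , GT.transport-refl I _ false g
        ; sym   = λ (e , f , g) → sym ∘ e , FT.transport-sym I e true f , GT.transport-sym I e false g
        ; trans = λ (e , f , g) (e′ , f′ , g′) → (λ i → trans (e i) (e′ i))
                    , FT.transport-trans I e e′ true f f′ , GT.transport-trans I e e′ false g g′
        }
      }
    ; isFinite = record
      { _≟_ = same? I
      ; elements = concatMap (λ p → concatMap (λ f → map (λ g → p , f , g) (elementsᴳ I p)) (elementsᶠ I p))
                             (FinSetoid.elements (subsets I))
      ; complete = λ (p , f , g) → Any.concatMap⁺ _ (Any.map (λ {q} e →
          Any.concatMap⁺ _ (Any.map (λ f≈ →
            Any.map⁺ (Any.map (λ g≈ → e , f≈ , g≈)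
              (FinSetoid.complete (G [ block I q false ]) (transport G I e false g))))
            (FinSetoid.complete (F [ block I q true ]) (transport F I e true f))))
          (FinSetoid.complete (subsets I) p))
      }
    }
  ; relabel = λ {I} {J} φ (p , f , g) →
      p ∘ Inverse.from φ , moveBlock F I J φ p true f , moveBlock G I J φ p false g
  ; relabel-resp = λ {I} {J} φ ψ φ≗ψ {s} {t} (e , f , g) →
      let e′ = λ j → trans (cong (proj₁ s) (from-≗ φ ψ φ≗ψ j)) (e (Inverse.from ψ j)) in
      e′ , FT.moveBlock-resp I J φ ψ e e′ true φ≗ψ f , GT.moveBlock-resp I J φ ψ e e′ false φ≗ψ g
  ; relabel-id = λ {I} (p , f , g) →
      (λ _ → refl) , FT.moveBlock-id I p true f , GT.moveBlock-id I p false g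
  ; relabel-∘ = λ {I} {J} {K} φ ψ (p , f , g) →
      (λ _ → refl) , FT.moveBlock-∘ I J K φ ψ p true f , GT.moveBlock-∘ I J K φ ψ p false g
  }
  where
  module FT = Transport F
  module GT = Transport G

  Structure : FinSet → Set
  Structure I = Σ[ p ∈ (∣ I ∣ → Bool) ] Elem (F [ block I p true ]) × Elem (G [ block I p false ])

  Same : ∀ I → Structure I → Structure I → Set
  Same I (p , f , g) (q , f′ , g′) = Σ[ e ∈ (∀ i → p i ≡ q i) ]
    FinSetoid._≈_ (F [ block I q true ]) (transport F I e true f) f′ ×
    FinSetoid._≈_ (G [ block I q false ]) (transport G I e false g) g′

  elementsᶠ : ∀ I p → List (Elem (F [ block I p true ]))
  elementsᶠ I p = FinSetoid.elements (F [ block I p true ])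

  elementsᴳ : ∀ I p → List (Elem (G [ block I p false ]))
  elementsᴳ I p = FinSetoid.elements (G [ block I p false ])

  same? : ∀ I → Decidable (Same I)
  same? I (p , f , g) (q , f′ , g′) with FinSetoid._≟_ (subsets I) p q
  ... | no p≢q = no (p≢q ∘ proj₁)
  ... | yes e  = map′ (e ,_)
    (λ (e′ , f≈ , g≈) →
      FinSetoid.trans (F [ block I q true ]) (FT.transport-≡ I e e′ true f) f≈ ,
      FinSetoid.trans (G [ block I q false ]) (GT.transport-≡ I e e′ false g) g≈)
    (FinSetoid._≟_ (F [ block I q true ]) _ f′ ×-dec FinSetoid._≟_ (G [ block I q false ]) _ g′)

mkIso : ∀ {F G} (to : ∀ I → Elem (F [ I ]) → Elem (G [ I ])) (from : ∀ I → Elem (G [ I ]) → Elem (F [ I ])) →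
        (∀ I {s t} → FinSetoid._≈_ (F [ I ]) s t → FinSetoid._≈_ (G [ I ]) (to I s) (to I t)) →
        (∀ I {s t} → FinSetoid._≈_ (G [ I ]) s t → FinSetoid._≈_ (F [ I ]) (from I s) (from I t)) →
        (∀ I s → FinSetoid._≈_ (G [ I ]) (to I (from I s)) s) →
        (∀ I s → FinSetoid._≈_ (F [ I ]) (from I (to I s)) s) →
        (∀ I J (φ : ∣ I ∣ ↔ ∣ J ∣) s → FinSetoid._≈_ (G [ J ]) (to J (Species.relabel F {I} {J} φ s))
                                                           (Species.relabel G {I} {J} φ (to I s))) →
        F ≅ G
mkIso {F} {G} to from to-cong from-cong to-from from-to natural = record
  { iso = λ I → record
    { to = to I ; from = from I ; to-cong = to-cong I ; from-cong = from-cong I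
    ; inverse = (λ e → FinSetoid.trans (G [ I ]) (to-cong I e) (to-from I _))
              , (λ e → FinSetoid.trans (F [ I ]) (from-cong I e) (from-to I _))
    }
  ; natural = λ {I} {J} → natural I J
  }

≅-refl : ∀ {F} → F ≅ F
≅-refl {F} = mkIso {F} {F} (λ _ → id) (λ _ → id) (λ _ → id) (λ _ → id)
  (λ I _ → FinSetoid.refl (F [ I ])) (λ I _ → FinSetoid.refl (F [ I ]))
  (λ _ J _ _ → FinSetoid.refl (F [ J ]))

≅-sym : ∀ {F G} → F ≅ G → G ≅ F
≅-sym {F} {G} α = record
  { iso     = λ I → Symmetry.inverse (α.iso I)
  ; natural = λ {I} {J} φ s → FinSetoid.trans (F [ J ])
      (Inverse.from-cong (α.iso J) (FinSetoid.trans (G [ J ])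
        (Species.relabel-resp G {I} {J} φ φ (λ _ → refl)
          (FinSetoid.sym (G [ I ]) (Inverse.strictlyInverseˡ (α.iso I) s)))
        (FinSetoid.sym (G [ J ]) (α.natural {I} {J} φ (Inverse.from (α.iso I) s)))))
      (Inverse.strictlyInverseʳ (α.iso J) _)
  }
  where module α = _≅_ α

≅-trans : ∀ {F G H} → F ≅ G → G ≅ H → F ≅ H
≅-trans {F} {G} {H} α β = record
  { iso     = λ I → Compose.inverse (α.iso I) (β.iso I)
  ; natural = λ {I} {J} φ s → FinSetoid.trans (H [ J ])
      (Inverse.to-cong (β.iso J) (α.natural {I} {J} φ s)) (β.natural {I} {J} φ _)
  }
  where
  module α = _≅_ α
  module β = _≅_ β

⊕-cong : ∀ {F F′ G G′} → F ≅ F′ → G ≅ G′ → F ⊕ G ≅ F′ ⊕ G′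
⊕-cong {F} {F′} {G} {G′} α β = mkIso {F ⊕ G} {F′ ⊕ G′}
  (λ I → Sum.map (α.to I) (β.to I))
  (λ I → Sum.map (α.from I) (β.from I))
  (λ I → λ { (inj₁ e) → inj₁ (α.to-cong I e) ; (inj₂ e) → inj₂ (β.to-cong I e) })
  (λ I → λ { (inj₁ e) → inj₁ (α.from-cong I e) ; (inj₂ e) → inj₂ (β.from-cong I e) })
  (λ I → λ { (inj₁ f) → inj₁ (α.strictlyInverseˡ I f) ; (inj₂ g) → inj₂ (β.strictlyInverseˡ I g) })
  (λ I → λ { (inj₁ f) → inj₁ (α.strictlyInverseʳ I f) ; (inj₂ g) → inj₂ (β.strictlyInverseʳ I g) })
  (λ I J φ → λ { (inj₁ f) → inj₁ (_≅_.natural α {I} {J} φ f) ; (inj₂ g) → inj₂ (_≅_.natural β {I} {J} φ g) })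
  where
  module α I = Inverse (_≅_.iso α I)
  module β I = Inverse (_≅_.iso β I)

⊙-cong : ∀ {F F′ G G′} → F ≅ F′ → G ≅ G′ → F ⊙ G ≅ F′ ⊙ G′
⊙-cong {F} {F′} {G} {G′} α β = mkIso {F ⊙ G} {F′ ⊙ G′}
  (λ I (p , f , g) → p , α.to (block I p true) f , β.to (block I p false) g)
  (λ I (p , f , g) → p , α.from (block I p true) f , β.from (block I p false) g)
  (λ I (e , f , g) → e , natural-cong α I e true f , natural-cong β I e false g)
  (λ I (e , f , g) → e , natural-cong (≅-sym α) I e true f , natural-cong (≅-sym β) I e false g)
  (λ I (p , f , g) → (λ _ → refl) , refl-by F′ I true (α.strictlyInverseˡ _ f) , refl-by G′ I false (β.strictlyInverseˡ _ g))
  (λ I (p , f , g) → (λ _ → refl) , refl-by F I true (α.strictlyInverseʳ _ f) , refl-by G I false (β.strictlyInverseʳ _ g))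
  (λ I J φ (p , f , g) → (λ _ → refl)
    , refl-by F′ J true (_≅_.natural α {block I p true} {block J _ true} (restrict φ _ true) f)
    , refl-by G′ J false (_≅_.natural β {block I p false} {block J _ false} (restrict φ _ false) g))
  where
  module α I = Inverse (_≅_.iso α I)
  module β I = Inverse (_≅_.iso β I)

  refl-by : ∀ F I {p : ∣ I ∣ → Bool} b {f g} → FinSetoid._≈_ (F [ block I p b ]) f g →
            FinSetoid._≈_ (F [ block I p b ]) (transport F I (λ _ → refl) b f) g
  refl-by F I {p} b e = FinSetoid.trans (F [ block I p b ]) (Transport.transport-refl F I (λ _ → refl) b _) e

  natural-cong : ∀ {F G} (α : F ≅ G) I {p q : ∣ I ∣ → Bool} (e : ∀ i → p i ≡ q i) b {f g} →
    FinSetoid._≈_ (F [ block I q b ]) (transport F I e b f) g →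
    FinSetoid._≈_ (G [ block I q b ]) (transport G I e b (Inverse.to (_≅_.iso α (block I p b)) f))
                                      (Inverse.to (_≅_.iso α (block I q b)) g)
  natural-cong {F} {G} α I {p} {q} e b {f} f≈ = FinSetoid.trans (G [ block I q b ])
    (FinSetoid.sym (G [ block I q b ]) (_≅_.natural α {block I p b} {block I q b} (restrict (↔-id _) e b) f))
    (Inverse.to-cong (_≅_.iso α (block I q b)) f≈)

⊕-identityʳ : ∀ F → F ⊕ 𝟘 ≅ F
⊕-identityʳ F = mkIso {F ⊕ 𝟘} {F}
  (λ I → λ { (inj₁ f) → f }) (λ I → inj₁) (λ I → λ { (inj₁ e) → e }) (λ I → inj₁)
  (λ I _ → FinSetoid.refl (F [ I ])) (λ I → λ { (inj₁ f) → inj₁ (FinSetoid.refl (F [ I ])) })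
  (λ I J φ → λ { (inj₁ f) → FinSetoid.refl (F [ J ]) })

⊕-identityˡ : ∀ F → 𝟘 ⊕ F ≅ F
⊕-identityˡ F = mkIso {𝟘 ⊕ F} {F}
  (λ I → λ { (inj₂ f) → f }) (λ I → inj₂) (λ I → λ { (inj₂ e) → e }) (λ I → inj₂)
  (λ I _ → FinSetoid.refl (F [ I ])) (λ I → λ { (inj₂ f) → inj₂ (FinSetoid.refl (F [ I ])) })
  (λ I J φ → λ { (inj₂ f) → FinSetoid.refl (F [ J ]) })

⊙-zeroʳ : ∀ F → F ⊙ 𝟘 ≅ 𝟘
⊙-zeroʳ F = mkIso {F ⊙ 𝟘} {𝟘} (λ I ()) (λ I ()) (λ I {s} _ → ⊥-elim (proj₂ (proj₂ s))) (λ I {s} _ → ⊥-elim s)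
  (λ I ()) (λ I ()) (λ I J φ ())

⊙-identityˡ : ∀ F → 𝟙 ⊙ F ≅ F
⊙-identityˡ F = mkIso {𝟙 ⊙ F} {F}
  (λ I (p , empty , f) → F.relabel {block I p false} {I} (whole I p (all-false I p empty)) f)
  (λ I f → (λ _ → false) , (λ ()) , F.relabel {I} {block I _ false} (part I) f)
  (λ I {(p , empty , f)} {(q , empty′ , f′)} (e , _ , f≈) → FinSetoid.trans (F [ I ])
    (F.relabel-∘′ {block I p false} {block I q false} {I} (restrict (↔-id _) e false) (whole I q (all-false I q empty′)) (whole I p _) (λ _ → refl) f)
    (F.relabel-resp {block I q false} {I} (whole I q _) (whole I q _) (λ _ → refl) f≈))
  (λ I f≈ → (λ _ → refl) , tt , FinSetoid.trans (F [ block I _ false ])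
    (Transport.transport-refl F I (λ _ → refl) false _)
    (F.relabel-resp {I} {block I _ false} (part I) (part I) (λ _ → refl) f≈))
  (λ I f → FinSetoid.trans (F [ I ])
    (FinSetoid.sym (F [ I ]) (F.relabel-∘ {I} {block I _ false} {I} (part I) (whole I _ _) f))
    (F.relabel-id′ {I} _ (λ _ → refl) f))
  (λ I (p , empty , f) → (λ i → sym (all-false I p empty i)) , tt ,
    (let module R = FinSetoid (F [ block I p false ])
         w = whole I p (all-false I p empty)
         r = restrict (↔-id _) (λ i → sym (all-false I p empty i)) false in
     R.trans
      (F.relabel-resp {block I _ false} {block I p false} r r (λ _ → refl)
        (FinSetoid.sym (F [ block I _ false ])
          (F.relabel-∘ {block I p false} {I} {block I _ false} w (part I) f)))
      (R.trans
        (R.sym (F.relabel-∘ {block I p false} {block I _ false} {block I p false} (part I ↔-∘ w) r f))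
        (F.relabel-id′ {block I p false} (r ↔-∘ (part I ↔-∘ w)) (λ _ → block-≡ refl) f))))
  (λ I J φ (p , empty , f) →
    F.relabel-square {block I p false} {block J _ false} {J} {I}
      (restrict φ _ false) (whole J _ _) (whole I p _) φ (λ _ → refl) f)
  where
  module F = Species F

  all-false : ∀ I (p : ∣ I ∣ → Bool) → ¬ ∣ block I p true ∣ → ∀ i → p i ≡ false
  all-false I p empty i with p i in e
  ... | true  = ⊥-elim (empty (i , e))
  ... | false = refl

  whole : ∀ I (p : ∣ I ∣ → Bool) → (∀ i → p i ≡ false) → ∣ block I p false ∣ ↔ ∣ I ∣
  whole I p e = mk↔ₛ′ proj₁ (λ i → i , e i) (λ _ → refl) (λ _ → block-≡ refl)

  part : ∀ I → ∣ I ∣ ↔ ∣ block I (λ _ → false) false ∣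
  part I = mk↔ₛ′ (λ i → i , refl) proj₁ (λ _ → block-≡ refl) (λ _ → refl)

infixr 9 _^_

_^_ : Species → ℕ → Species
F ^ zero  = 𝟙
F ^ suc k = F ⊙ F ^ k

size : FinSet → ℕ
size I = length (FinSet.elements I)

block-size-< : ∀ I p {i : ∣ I ∣} → p i ≡ true → size (block I p false) < size I
block-size-< I p {i} e = strict (FinSet.elements I) (FinSet.complete I i)
  where
  f : ∣ I ∣ → List (∣ block I p false ∣)
  f i = map (i ,_) (decList (p i Bool.≟ false))

  f-≤ : ∀ i → length (f i) ≤ 1
  f-≤ i with p i Bool.≟ false
  ... | yes _ = s≤s z≤n
  ... | no  _ = z≤n

  f-0 : ∀ i → p i ≡ true → length (f i) ≤ 0
  f-0 i e with p i Bool.≟ false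
  ... | yes e′ with () ← trans (sym e) e′
  ... | no  _  = z≤n

  length-f : ∀ i is {m n} → length (f i) ≤ m → length (concatMap f is) ≤ n →
             length (concatMap f (i ∷ is)) ≤ m + n
  length-f i is a b rewrite length-++ (f i) {concatMap f is} = ℕ.+-mono-≤ a b

  weak : ∀ is → length (concatMap f is) ≤ length is
  weak []       = z≤n
  weak (i ∷ is) = length-f i is (f-≤ i) (weak is)

  strict : ∀ is → Any (i ≡_) is → length (concatMap f is) < length is
  strict (i ∷ is) (here refl) = s≤s (length-f i is (f-0 i e) (weak is))
  strict (i ∷ is) (there i∈)  = s≤s (ℕ.≤-trans (length-f i is (f-≤ i) ℕ.≤-refl) (strict is i∈))

X^-bound : ∀ k I → Elem ((X ^ k) [ I ]) → k ≤ size I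
X^-bound zero    I _ = z≤n
X^-bound (suc k) I (p , ((_ , e) , _) , s) =
  ℕ.≤-trans (s≤s (X^-bound k (block I p false) s)) (block-size-< I p e)

-- The infinite sum of the species X ^ k, which is finite on each I by X^-bound.
Geometric : Species
Geometric = record
  { _[_] = λ I → record
    { setoid′ = record
      { Carrier = Σ[ k ∈ ℕ ] Elem ((X ^ k) [ I ])
      ; _≈_ = Same I
      ; isEquivalence = record
        { refl  = λ {(k , s)} → refl , FinSetoid.refl ((X ^ k) [ I ])
        ; sym   = λ { {k , s} (refl , e) → refl , FinSetoid.sym ((X ^ k) [ I ]) e }
        ; trans = λ { {k , s} (refl , e) (refl , e′) → refl , FinSetoid.trans ((X ^ k) [ I ]) e e′ }
        }
      }
    ; isFinite = record
      { _≟_ = same? I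
      ; elements = concatMap (λ k → map (k ,_) (FinSetoid.elements ((X ^ k) [ I ]))) (upTo (suc (size I)))
      ; complete = λ (k , s) → Any.concatMap⁺ _
          (Any.map (λ { refl → Any.map⁺ (Any.map (refl ,_) (FinSetoid.complete ((X ^ k) [ I ]) s)) })
                   (∈-upTo⁺ (s≤s (X^-bound k I s))))
      }
    }
  ; relabel      = λ {I} {J} φ (k , s) → k , Species.relabel (X ^ k) {I} {J} φ s
  ; relabel-resp = λ { {I} {J} φ ψ φ≗ψ {k , s} (refl , e) → refl , Species.relabel-resp (X ^ k) {I} {J} φ ψ φ≗ψ e }
  ; relabel-id   = λ { {I} (k , s) → refl , Species.relabel-id (X ^ k) {I} s }
  ; relabel-∘    = λ { {I} {J} {K} φ ψ (k , s) → refl , Species.relabel-∘ (X ^ k) {I} {J} {K} φ ψ s }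
  }
  where
  Same : ∀ I → (s t : Σ[ k ∈ ℕ ] Elem ((X ^ k) [ I ])) → Set
  Same I (k , s) (l , t) = Σ[ e ∈ k ≡ l ]
    FinSetoid._≈_ ((X ^ l) [ I ]) (subst (λ k → Elem ((X ^ k) [ I ])) e s) t

  same? : ∀ I → Decidable (Same I)
  same? I (k , s) (l , t) with k ℕ.≟ l
  ... | no k≢l   = no (k≢l ∘ proj₁)
  ... | yes refl = map′ (refl ,_)
    (λ (e , s≈t) → subst (λ e → FinSetoid._≈_ ((X ^ k) [ I ]) (subst (λ k → Elem ((X ^ k) [ I ])) e s) t) (ℕ.≡-irrelevant e refl) s≈t)
    (FinSetoid._≟_ ((X ^ k) [ I ]) s t)

Geometric-unfold : Geometric ≅ 𝟙 ⊕ X ⊙ Geometric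
Geometric-unfold = mkIso {Geometric} {𝟙 ⊕ X ⊙ Geometric} to from
  (λ { I {zero , _} (refl , e) → inj₁ tt
     ; I {suc k , _} (refl , e , x , s) → inj₂ (e , x , refl , s) })
  (λ { I (inj₁ _) → refl , tt
     ; I (inj₂ (e , x , refl , s)) → refl , e , x , s })
  (λ { I (inj₁ _) → inj₁ tt
     ; I (inj₂ (p , x , k , s)) → inj₂ (FinSetoid.refl ((X ⊙ Geometric) [ I ]) {p , x , k , s}) })
  (λ { I (zero , _) → refl , tt
     ; I (suc k , s) → refl , FinSetoid.refl ((X ^ suc k) [ I ]) {s} })
  (λ { I J φ (zero , _) → inj₁ tt
     ; I J φ (suc k , p , x , s) → inj₂ (FinSetoid.refl ((X ⊙ Geometric) [ J ])
         {Species.relabel (X ⊙ Geometric) {I} {J} φ (p , x , k , s)}) })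
  where
  to : ∀ I → Elem (Geometric [ I ]) → Elem ((𝟙 ⊕ X ⊙ Geometric) [ I ])
  to I (zero  , empty)     = inj₁ empty
  to I (suc k , p , x , s) = inj₂ (p , x , k , s)

  from : ∀ I → Elem ((𝟙 ⊕ X ⊙ Geometric) [ I ]) → Elem (Geometric [ I ])
  from I (inj₁ empty)           = zero , empty
  from I (inj₂ (p , x , k , s)) = suc k , p , x , s

record Virtual : Set₁ where
  constructor _⊖_
  field
    pos neg : Species

open Virtual public

⟦_⟧ : Species → Virtual
⟦ F ⟧ = F ⊖ 𝟘

infix  4 _≈ᵛ_
infixl 6 _+ᵛ_ _-ᵛ_
infixl 7 _*ᵛ_
infix  8 1/_

_≈ᵛ_ : Virtual → Virtual → Set₁
F ≈ᵛ G = pos F ⊕ neg G ≅ pos G ⊕ neg F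

_+ᵛ_ _-ᵛ_ _*ᵛ_ : Virtual → Virtual → Virtual
F +ᵛ G = (pos F ⊕ pos G) ⊖ (neg F ⊕ neg G)
F -ᵛ G = (pos F ⊕ neg G) ⊖ (neg F ⊕ pos G)
F *ᵛ G = (pos F ⊙ pos G ⊕ neg F ⊙ neg G) ⊖ (pos F ⊙ neg G ⊕ neg F ⊙ pos G)

1ᵛ : Virtual
1ᵛ = ⟦ 𝟙 ⟧

record Unit (F : Virtual) : Set₁ where
  field
    inverse   : Virtual
    isInverse : F *ᵛ inverse ≈ᵛ 1ᵛ

-- Inverses in a commutative ring are unique, so up to _≈ᵛ_ the value of 1/ F
-- does not depend on the instance.
1/_ : (F : Virtual) → ⦃ Unit F ⦄ → Virtual
1/_ F ⦃ u ⦄ = Unit.inverse u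

instance
  1-X-unit : Unit (1ᵛ -ᵛ ⟦ X ⟧)
  1-X-unit = record { inverse = ⟦ Geometric ⟧ ; isInverse = ≅-trans lhs (≅-sym rhs) }
    where
    open Virtual ((1ᵛ -ᵛ ⟦ X ⟧) *ᵛ ⟦ Geometric ⟧) renaming (pos to P; neg to N)

    lhs : P ⊕ 𝟘 ≅ Geometric
    lhs = ≅-trans (⊕-identityʳ P)
         (≅-trans (⊕-cong (≅-trans (⊙-cong (⊕-identityʳ 𝟙) ≅-refl) (⊙-identityˡ Geometric))
                          (⊙-zeroʳ (𝟘 ⊕ X)))
                  (⊕-identityʳ Geometric))

    rhs : 𝟙 ⊕ N ≅ Geometric
    rhs = ≅-trans (⊕-cong ≅-refl
           (≅-trans (⊕-cong (⊙-zeroʳ (𝟙 ⊕ 𝟘)) (⊙-cong (⊕-identityˡ X) ≅-refl))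
                    (⊕-identityˡ (X ⊙ Geometric))))
          (≅-sym Geometric-unfold)

record Graph (I : Set) : Set where
  field
    adj       : I → I → Bool
    symmetric : ∀ i j → adj i j ≡ adj j i
    loopless  : ∀ i → adj i i ≡ false

open Graph using (adj)

_≈ᴳ_ : ∀ {I} → Graph I → Graph I → Set
g ≈ᴳ h = ∀ i j → adj g i j ≡ adj h i j

relabelᴳ : ∀ {I J} → I ↔ J → Graph I → Graph J
relabelᴳ φ g = record
  { adj       = λ i j → adj g (φ.from i) (φ.from j)
  ; symmetric = λ i j → Graph.symmetric g (φ.from i) (φ.from j)
  ; loopless  = λ i → Graph.loopless g (φ.from i)
  }
  where module φ = Inverse φ

relabelᴳ-resp : ∀ {I J} (φ ψ : I ↔ J) → (∀ i → Inverse.to φ i ≡ Inverse.to ψ i) →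
                ∀ {g h} → g ≈ᴳ h → relabelᴳ φ g ≈ᴳ relabelᴳ ψ h
relabelᴳ-resp φ ψ φ≗ψ {g} e i j =
  trans (cong₂ (adj g) (from-≗ φ ψ φ≗ψ i) (from-≗ φ ψ φ≗ψ j)) (e _ _)

graphs : FinSet → FinSetoid
graphs I = record
  { setoid′ = record
    { Carrier = Graph ∣ I ∣
    ; _≈_ = _≈ᴳ_
    ; isEquivalence = record
      { refl  = λ _ _ → refl
      ; sym   = λ e i j → sym (e i j)
      ; trans = λ e e′ i j → trans (e i j) (e′ i j)
      }
    }
  ; isFinite = record
    { _≟_ = λ g h → IsFinite._≟_ matrices (adj g) (adj h)
    ; elements = concatMap (λ a → map (mk a) (decList (valid? a))) (IsFinite.elements matrices)
    ; complete = λ g → Any.concatMap⁺ _ (Any.map (λ {a} e →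
        decList⁺ (valid? a) (λ _ → e)
          ( (λ i j → trans (sym (e i j)) (trans (Graph.symmetric g i j) (e j i)))
          , (λ i → trans (sym (e i i)) (Graph.loopless g i))))
        (IsFinite.complete matrices (adj g)))
    }
  }
  where
  matrices : IsFinite (I ⇒ (I ⇒ setoid Bool))
  matrices = ⇒-isFinite I (I ⇒ setoid Bool) (λ _ → false) (FinSetoid.isFinite (subsets I))

  Valid : (∣ I ∣ → ∣ I ∣ → Bool) → Set
  Valid a = (∀ i j → a i j ≡ a j i) × (∀ i → a i i ≡ false)

  valid? : ∀ a → Dec (Valid a)
  valid? a = all? I (λ i → all? I (λ j → a i j Bool.≟ a j i)) ×-dec all? I (λ i → a i i Bool.≟ false)

  mk : ∀ a → Valid a → Graph ∣ I ∣
  mk a (s , l) = record { adj = a ; symmetric = s ; loopless = l }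

IsClique IsStable : ∀ {I} → Graph I → (I → Bool) → Set
IsClique g K = ∀ i j → K i ≡ true → K j ≡ true → i ≢ j → adj g i j ≡ true
IsStable g S = ∀ i j → S i ≡ true → S j ≡ true → adj g i j ≡ false

IsSplitPartition : ∀ {I} → Graph I → (I → Bool) → Set
IsSplitPartition g K = IsClique g K × IsStable g (not ∘ K)

record SplitGraph (I : Set) : Set where
  field
    graph   : Graph I
    isSplit : ∃[ K ] IsSplitPartition graph K

open SplitGraph using (graph)

Split : Species
Split = record
  { _[_] = λ I → record
    { setoid′ = record
      { Carrier = SplitGraph ∣ I ∣
      ; _≈_ = λ g h → graph g ≈ᴳ graph h
      ; isEquivalence = record
        { refl  = λ {g} → FinSetoid.refl (graphs I) {graph g}
        ; sym   = λ {g} {h} → FinSetoid.sym (graphs I) {graph g} {graph h}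
        ; trans = λ {g} {h} {k} → FinSetoid.trans (graphs I) {graph g} {graph h} {graph k}
        }
      }
    ; isFinite = record
      { _≟_ = λ g h → FinSetoid._≟_ (graphs I) (graph g) (graph h)
      ; elements = concatMap (λ g → concatMap (λ K → map (mk g K) (decList (split? I g K)))
                                              (FinSetoid.elements (subsets I)))
                             (FinSetoid.elements (graphs I))
      ; complete = λ s → let (K , clique , stable) = SplitGraph.isSplit s in
          Any.concatMap⁺ _ (Any.map (λ {g} e → Any.concatMap⁺ _ (Any.map (λ {K′} K≗K′ →
            decList⁺ {mk = mk g K′} (split? I g K′) (λ _ → e)
              ( (λ i j i∈ j∈ i≢j → trans (sym (e i j))
                  (clique i j (trans (K≗K′ i) i∈) (trans (K≗K′ j) j∈) i≢j))
              , (λ i j i∉ j∉ → trans (sym (e i j))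
                  (stable i j (trans (cong not (K≗K′ i)) i∉) (trans (cong not (K≗K′ j)) j∉)))))
            (FinSetoid.complete (subsets I) K)))
          (FinSetoid.complete (graphs I) (graph s)))
      }
    }
  ; relabel = λ φ s → let (K , clique , stable) = SplitGraph.isSplit s in record
    { graph   = relabelᴳ φ (graph s)
    ; isSplit = K ∘ Inverse.from φ
              , (λ i j i∈ j∈ i≢j → clique _ _ i∈ j∈ λ e →
                  i≢j (trans (sym (Inverse.strictlyInverseˡ φ i))
                      (trans (cong (Inverse.to φ) e) (Inverse.strictlyInverseˡ φ j))))
              , (λ i j → stable _ _)
    }
  ; relabel-resp = λ φ ψ φ≗ψ {s} {t} → relabelᴳ-resp φ ψ φ≗ψ {graph s} {graph t}
  ; relabel-id   = λ _ _ _ → refl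
  ; relabel-∘    = λ _ _ _ _ _ → refl
  }
  where
  split? : ∀ I (g : Graph ∣ I ∣) K → Dec (IsSplitPartition g K)
  split? I g K =
    all? I (λ i → all? I (λ j → (K i Bool.≟ true) →-dec ((K j Bool.≟ true) →-dec
      (¬? (FinSet._≟_ I i j) →-dec (adj g i j Bool.≟ true)))))
    ×-dec
    all? I (λ i → all? I (λ j → (not (K i) Bool.≟ true) →-dec ((not (K j) Bool.≟ true) →-dec
      (adj g i j Bool.≟ false))))

  mk : ∀ {I} (g : Graph I) K → IsSplitPartition g K → SplitGraph I
  mk g K h = record { graph = g ; isSplit = K , h }

data Color : Set where
  green red : Color

_≟ᶜ_ : DecidableEquality Color
green ≟ᶜ green = yes refl
green ≟ᶜ red   = no λ ()
red   ≟ᶜ green = no λ ()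
red   ≟ᶜ red   = yes refl

Color-isFinite : IsFinite (setoid Color)
Color-isFinite = record
  { _≟_      = _≟ᶜ_
  ; elements = green ∷ red ∷ []
  ; complete = λ { green → here refl ; red → there (here refl) }
  }

IsProper : ∀ {I} → Graph I → (I → Color) → Set
IsProper g c = ∀ i j → adj g i j ≡ true → c i ≢ c j

record BicoloredGraph (I : Set) : Set where
  field
    graph  : Graph I
    color  : I → Color
    proper : IsProper graph color

BC : Species
BC = record
  { _[_] = λ I → record
    { setoid′ = record
      { Carrier = BicoloredGraph ∣ I ∣
      ; _≈_ = λ b c → graphᴮ b ≈ᴳ graphᴮ c × (∀ i → color b i ≡ color c i)
      ; isEquivalence = record
        { refl  = (λ _ _ → refl) , (λ _ → refl)
        ; sym   = λ (e , f) → (λ i j → sym (e i j)) , (λ i → sym (f i))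
        ; trans = λ (e , f) (e′ , f′) → (λ i j → trans (e i j) (e′ i j)) , (λ i → trans (f i) (f′ i))
        }
      }
    ; isFinite = record
      { _≟_ = λ b c → FinSetoid._≟_ (graphs I) (graphᴮ b) (graphᴮ c)
                      ×-dec IsFinite._≟_ (colorings I) (color b) (color c)
      ; elements = concatMap (λ g → concatMap (λ c → map (mk g c) (decList (proper? I g c)))
                                              (IsFinite.elements (colorings I)))
                             (FinSetoid.elements (graphs I))
      ; complete = λ b →
          Any.concatMap⁺ _ (Any.map (λ {g} e → Any.concatMap⁺ _ (Any.map (λ {c} f →
            decList⁺ {mk = mk g c} (proper? I g c) (λ _ → e , f)
              (λ i j a ci≡cj → proper b i j (trans (e i j) a) (trans (f i) (trans ci≡cj (sym (f j))))))
            (IsFinite.complete (colorings I) (color b))))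
          (FinSetoid.complete (graphs I) (graphᴮ b)))
      }
    }
  ; relabel = λ φ b → record
    { graph  = relabelᴳ φ (graphᴮ b)
    ; color  = color b ∘ Inverse.from φ
    ; proper = λ i j → proper b _ _
    }
  ; relabel-resp = λ φ ψ φ≗ψ {b} {c} (e , f) →
      relabelᴳ-resp φ ψ φ≗ψ {graphᴮ b} {graphᴮ c} e ,
      (λ i → trans (cong (color b) (from-≗ φ ψ φ≗ψ i)) (f _))
  ; relabel-id   = λ _ → (λ _ _ → refl) , (λ _ → refl)
  ; relabel-∘    = λ _ _ _ → (λ _ _ → refl) , (λ _ → refl)
  }
  where
  open BicoloredGraph using (color; proper) renaming (graph to graphᴮ)

  colorings : ∀ I → IsFinite (I ⇒ setoid Color)
  colorings I = ⇒-isFinite I (setoid Color) green Color-isFinite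

  proper? : ∀ I (g : Graph ∣ I ∣) c → Dec (IsProper g c)
  proper? I g c = all? I (λ i → all? I (λ j →
    (adj g i j Bool.≟ true) →-dec ¬? (c i ≟ᶜ c j)))

  mk : ∀ {I} (g : Graph I) c → IsProper g c → BicoloredGraph I
  mk g c h = record { graph = g ; color = c ; proper = h }

{-# OPTIONS --safe #-}

-- Filling in all edges among the green vertices turns a bicolored graph into a split
-- graph together with a partition K into a clique and a stable set.  Call v a swing
-- vertex if some such partition has v in the clique and another has it outside; then
-- its neighbourhood N(v) is itself the clique of a partition.  Any two partitions agree
-- off the swing vertices, and the swing vertices form a clique or a stable set, so there
-- is a default partition D putting all of them on the same side, and every other
-- partition is D flipped at a single swing vertex v.  Since the other vertices with
-- partition N(v) are an arbitrary bicolored graph, BC ≅ Split ⊕ X ⊙ BC.  Geometric ⊙ Split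
-- satisfies the same recursion, and X ⊙ _ strictly decreases the size of the label set,
-- so the two agree.

module Submission where

open import Defs
open import Data.Bool using (Bool; true; false; not; _∧_; _∨_; _xor_; if_then_else_)
import Data.Bool.Properties as Bool
open import Data.Empty using (⊥-elim)
import Data.List.Relation.Unary.All as All
import Data.List.Relation.Unary.All.Properties as All
import Data.List.Relation.Unary.Any as Any
open import Data.Maybe using (Maybe; just; nothing)
open import Data.Nat using (suc; _<_; s≤s)
import Data.Nat.Properties as ℕ
open import Data.Product using (Σ-syntax; ∃-syntax; _×_; _,_; proj₁; proj₂; map₂)
open import Data.Sum using (_⊎_; inj₁; inj₂)
open import Data.Sum.Relation.Binary.Pointwise using (inj₁; inj₂)
open import Data.Unit using (tt)
open import Function using (_∘_; id; Inverse; _↔_; mk↔ₛ′; mk⇔; Injective)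
open import Function.Construct.Composition using (_↔-∘_)
open import Function.Construct.Identity using (↔-id)
open import Function.Construct.Symmetry using (↔-sym)
open import Relation.Binary.PropositionalEquality
  using (_≡_; _≢_; refl; sym; trans; cong; cong₂; subst)
open import Relation.Nullary using (Dec; does; yes; no; ¬_)
open import Relation.Nullary.Decidable using (¬?; _→-dec_; dec-true; dec-false; decidable-stable; does-⇔)

open FinSet using (∣_∣)
open FinSetoid using (Elem)
open Species using (_[_]; relabel)
open Graph using (adj; symmetric; loopless)

-- Isomorphisms of species from equivariant maps

Inj : {A B : Set} → (A → B) → Set
Inj = Injective _≡_ _≡_

↔-inj : ∀ {A B : Set} (φ : A ↔ B) → Inj (Inverse.to φ)
↔-inj φ {x} {y} e = trans (sym (Inverse.strictlyInverseʳ φ x))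
  (trans (cong (Inverse.from φ) e) (Inverse.strictlyInverseʳ φ y))

-- Equivariance at the identity relabelling already makes `f` respect `≈`. The inverse picks
-- preimages, and injectivity of `f` gives its congruence and the remaining inverse law.
equivariant-iso : ∀ {F G} (f : ∀ I → Elem (F [ I ]) → Elem (G [ I ])) →
  (∀ I J (φ : ∣ I ∣ ↔ ∣ J ∣) {s t} → FinSetoid._≈_ (F [ J ]) (relabel F {I} {J} φ s) t →
     FinSetoid._≈_ (G [ J ]) (relabel G {I} {J} φ (f I s)) (f J t)) →
  (∀ I {s t} → FinSetoid._≈_ (G [ I ]) (f I s) (f I t) → FinSetoid._≈_ (F [ I ]) s t) →
  (∀ I t → ∃[ s ] FinSetoid._≈_ (G [ I ]) (f I s) t) →
  F ≅ G
equivariant-iso {F} {G} f equiv inj surj = mkIso {F} {G}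
  f (λ I t → proj₁ (surj I t)) f-cong
  (λ I {s} {t} e → inj I (let module G = FinSetoid (G [ I ]) in
     G.trans (proj₂ (surj I s)) (G.trans e (G.sym (proj₂ (surj I t))))))
  (λ I t → proj₂ (surj I t))
  (λ I s → inj I (proj₂ (surj I (f I s))))
  (λ I J φ s → FinSetoid.sym (G [ J ]) (equiv I J φ (FinSetoid.refl (F [ J ]))))
  where
  f-cong : ∀ I {s t} → FinSetoid._≈_ (F [ I ]) s t → FinSetoid._≈_ (G [ I ]) (f I s) (f I t)
  f-cong I {s} e = FinSetoid.trans (G [ I ])
    (FinSetoid.sym (G [ I ]) (Species.relabel-id G {I} (f I s)))
    (equiv I I (↔-id _) (FinSetoid.trans (F [ I ]) (Species.relabel-id F {I} s) e))

-- Products of species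

-- The structures f and g are the same once A and B are regarded, via a and b, as
-- subsets of U.  Products match exactly when their factors do, so products can be
-- rebracketed without following labels through nested blocks.
record Match (F : Species) {U : Set} {A B : FinSet}
             (a : ∣ A ∣ → U) (f : Elem (F [ A ])) (b : ∣ B ∣ → U) (g : Elem (F [ B ])) : Set where
  field
    bij   : ∣ A ∣ ↔ ∣ B ∣
    over  : ∀ x → b (Inverse.to bij x) ≡ a x
    match : FinSetoid._≈_ (F [ B ]) (relabel F {A} {B} bij f) g

  over⁻ : ∀ y → a (Inverse.from bij y) ≡ b y
  over⁻ y = trans (sym (over _)) (cong b (Inverse.strictlyInverseˡ bij y))

module _ (F : Species) {U : Set} where
  private module F = Species F

  Match-relabel : ∀ {A B} (φ : ∣ A ∣ ↔ ∣ B ∣) (b : ∣ B ∣ → U) f →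
                  Match F {A = A} {B} (b ∘ Inverse.to φ) f b (F.relabel {A} {B} φ f)
  Match-relabel {A} {B} φ b f = record { bij = φ ; over = λ _ → refl ; match = FinSetoid.refl (F [ B ]) }

  Match-sym : ∀ {A B} {a : ∣ A ∣ → U} {f} {b : ∣ B ∣ → U} {g} →
              Match F {A = A} {B} a f b g → Match F {A = B} {A} b g a f
  Match-sym {A} {B} {a} {f} {b} m = record
    { bij   = ↔-sym m.bij
    ; over  = m.over⁻
    ; match = FinSetoid.trans (F [ A ])
        (F.relabel-resp {B} {A} (↔-sym m.bij) (↔-sym m.bij) (λ _ → refl) (FinSetoid.sym (F [ B ]) m.match))
        (FinSetoid.trans (F [ A ])
          (FinSetoid.sym (F [ A ]) (F.relabel-∘ {A} {B} {A} m.bij (↔-sym m.bij) f))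
          (F.relabel-id′ {A} (↔-sym m.bij ↔-∘ m.bij) (Inverse.strictlyInverseʳ m.bij) f))
    }
    where module m = Match m

  Match-trans : ∀ {A B C} {a : ∣ A ∣ → U} {f} {b : ∣ B ∣ → U} {g} {c : ∣ C ∣ → U} {h} →
                Match F {A = A} {B} a f b g → Match F {A = B} {C} b g c h → Match F {A = A} {C} a f c h
  Match-trans {A} {B} {C} {f = f} m n = record
    { bij   = n.bij ↔-∘ m.bij
    ; over  = λ x → trans (n.over _) (m.over x)
    ; match = FinSetoid.trans (F [ C ]) (F.relabel-∘ {A} {B} {C} m.bij n.bij f)
        (FinSetoid.trans (F [ C ]) (F.relabel-resp {B} {C} n.bij n.bij (λ _ → refl) m.match) n.match)
    }
    where module m = Match m
          module n = Match n

  -- Injectivity of `b` allows only one bijection over `U`, so `φ` agrees pointwise with the one in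
  -- the match.
  Match-elim : ∀ {A B} {a : ∣ A ∣ → U} {f} {b : ∣ B ∣ → U} {g} → Inj b →
               Match F {A = A} {B} a f b g → (φ : ∣ A ∣ ↔ ∣ B ∣) → (∀ x → b (Inverse.to φ x) ≡ a x) →
               FinSetoid._≈_ (F [ B ]) (F.relabel {A} {B} φ f) g
  Match-elim {A} {B} b-inj m φ φ-over = FinSetoid.trans (F [ B ])
    (F.relabel-resp {A} {B} φ m.bij (λ x → b-inj (trans (φ-over x) (sym (m.over x)))) (FinSetoid.refl (F [ A ])))
    m.match
    where module m = Match m

proj₁-inj : ∀ {A : Set} {p : A → Bool} {b} → Inj (proj₁ {B = λ i → p i ≡ b})
proj₁-inj = block-≡

-- Points are determined by their images in `U`, so the maps chosen by `f` and `g` are mutually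
-- inverse.
bijection-over : ∀ {A B U : Set} {a : A → U} {b : B → U} → Inj a → Inj b →
  (f : ∀ x → ∃[ y ] b y ≡ a x) (g : ∀ y → ∃[ x ] a x ≡ b y) → A ↔ B
bijection-over a-inj b-inj f g = mk↔ₛ′ (proj₁ ∘ f) (proj₁ ∘ g)
  (λ y → b-inj (trans (proj₂ (f _)) (proj₂ (g y))))
  (λ x → a-inj (trans (proj₂ (g _)) (proj₂ (f x))))

module _ (F G : Species) {U : Set} {A B : FinSet} {a : ∣ A ∣ → U} {b : ∣ B ∣ → U}
         {p : ∣ A ∣ → Bool} {f : Elem (F [ block A p true ])} {g : Elem (G [ block A p false ])}
         {q : ∣ B ∣ → Bool} {f′ : Elem (F [ block B q true ])} {g′ : Elem (G [ block B q false ])} where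
  private
    module F = Species F
    module G = Species G

  Match-⊙⁻ : Match (F ⊙ G) {A = A} {B} a (p , f , g) b (q , f′ , g′) →
    Match F {A = block A p true} {block B q true} (a ∘ proj₁) f (b ∘ proj₁) f′ ×
    Match G {A = block A p false} {block B q false} (a ∘ proj₁) g (b ∘ proj₁) g′
  Match-⊙⁻ record { bij = φ ; over = over ; match = e , f≈ , g≈ } =
      record { bij = restrict (↔-id _) e true ↔-∘ restrict φ _ true
             ; over = λ x → over (proj₁ x)
             ; match = FinSetoid.trans (F [ block B q true ])
                 (F.relabel-∘ {block A p true} {block B _ true} {block B q true}
                   (restrict φ _ true) (restrict (↔-id _) e true) f) f≈ }
    , record { bij = restrict (↔-id _) e false ↔-∘ restrict φ _ false
             ; over = λ x → over (proj₁ x)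
             ; match = FinSetoid.trans (G [ block B q false ])
                 (G.relabel-∘ {block A p false} {block B _ false} {block B q false}
                   (restrict φ _ false) (restrict (↔-id _) e false) g) g≈ }

  -- The two block bijections glue to one from `A` to `B`. `Match-elim` then exchanges each of them
  -- for the restriction of the glued one.
  Match-⊙⁺ : Inj a → Inj b →
    Match F {A = block A p true} {block B q true} (a ∘ proj₁) f (b ∘ proj₁) f′ →
    Match G {A = block A p false} {block B q false} (a ∘ proj₁) g (b ∘ proj₁) g′ →
    Match (F ⊙ G) {A = A} {B} a (p , f , g) b (q , f′ , g′)
  Match-⊙⁺ a-inj b-inj m n = record
    { bij   = φ
    ; over  = proj₂ ∘ proj₂ ∘ f⁺
    ; match = e
        , FinSetoid.trans (F [ block B q true ])
            (FinSetoid.sym (F [ block B q true ])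
              (F.relabel-∘ {block A p true} {block B _ true} {block B q true}
                   (restrict φ _ true) (restrict (↔-id _) e true) f))
            (Match-elim F (block-≡ ∘ b-inj) m _ (λ x → proj₂ (proj₂ (f⁺ (proj₁ x)))))
        , FinSetoid.trans (G [ block B q false ])
            (FinSetoid.sym (G [ block B q false ])
              (G.relabel-∘ {block A p false} {block B _ false} {block B q false}
                   (restrict φ _ false) (restrict (↔-id _) e false) g))
            (Match-elim G (block-≡ ∘ b-inj) n _ (λ x → proj₂ (proj₂ (f⁺ (proj₁ x)))))
    }
    where
    module m = Match m
    module n = Match n

    -- The equation `q y ≡ p x` is kept because the glued bijection must carry `p` to `q`.
    f⁺ : ∀ x → ∃[ y ] q y ≡ p x × b y ≡ a x
    f⁺ x with p x in e
    ... | true  = let (y , e′) = Inverse.to m.bij (x , e) in y , e′ , m.over _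
    ... | false = let (y , e′) = Inverse.to n.bij (x , e) in y , e′ , n.over _

    f⁻ : ∀ y → ∃[ x ] a x ≡ b y
    f⁻ y with q y in e
    ... | true  = proj₁ (Inverse.from m.bij (y , e)) , m.over⁻ (y , e)
    ... | false = proj₁ (Inverse.from n.bij (y , e)) , n.over⁻ (y , e)

    φ : ∣ A ∣ ↔ ∣ B ∣
    φ = bijection-over a-inj b-inj (λ x → map₂ proj₂ (f⁺ x)) f⁻

    e : ∀ y → p (Inverse.from φ y) ≡ q y
    e y = trans (sym (proj₁ (proj₂ (f⁺ (Inverse.from φ y))))) (cong q (Inverse.strictlyInverseˡ φ y))

-- Relabelling along `φ` is a match over `U = ∣ J ∣`, so a map that preserves matches is
-- equivariant.
match-iso : ∀ {F G} (f : ∀ I → Elem (F [ I ]) → Elem (G [ I ])) →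
  (∀ {U} I J (a : ∣ I ∣ → U) (b : ∣ J ∣ → U) → Inj a → Inj b → ∀ {s t} →
     Match F {A = I} {J} a s b t → Match G {A = I} {J} a (f I s) b (f J t)) →
  (∀ I {s t} → Match G {A = I} {I} id (f I s) id (f I t) → Match F {A = I} {I} id s id t) →
  (∀ I t → ∃[ s ] Match G {A = I} {I} id (f I s) id t) →
  F ≅ G
match-iso {F} {G} f equiv inj surj = equivariant-iso f
  (λ I J φ e → Match-elim G id
    (equiv I J (Inverse.to φ) id (↔-inj φ) id (record { bij = φ ; over = λ _ → refl ; match = e }))
    φ (λ _ → refl))
  (λ I e → match-id⁻ F I (inj I (match-id⁺ G I e)))
  (λ I t → map₂ (match-id⁻ G I) (surj I t))
  where
  match-id⁺ : ∀ F I {s t} → FinSetoid._≈_ (F [ I ]) s t → Match F {A = I} {I} id s id t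
  match-id⁺ F I {s} e = record
    { bij = ↔-id _ ; over = λ _ → refl ; match = FinSetoid.trans (F [ I ]) (Species.relabel-id F {I} s) e }

  match-id⁻ : ∀ F I {s t} → Match F {A = I} {I} id s id t → FinSetoid._≈_ (F [ I ]) s t
  match-id⁻ F I {s} m = FinSetoid.trans (F [ I ])
    (FinSetoid.sym (F [ I ]) (Species.relabel-id F {I} s)) (Match-elim F id m (↔-id _) (λ _ → refl))

-- Associativity and distributivity of the product

module Extend {A : Set} {b} (p : A → Bool) (q : Σ[ i ∈ A ] p i ≡ b → Bool) (d : Bool) where
  -- Regrouping factors turns a subset of a block into a subset of the whole set; `d` decides the
  -- side of the points outside the block.
  extended : A → Bool
  extended i with p i Bool.≟ b
  ... | yes e = q (i , e)
  ... | no  _ = d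

  inside : ∀ x → extended (proj₁ x) ≡ q x
  inside (i , e) with p i Bool.≟ b
  ... | yes _ = cong q (block-≡ refl)
  ... | no ¬e = ⊥-elim (¬e e)

  outside : ∀ i → p i ≡ not b → extended i ≡ d
  outside i e with p i Bool.≟ b
  ... | yes e′ = ⊥-elim (Bool.not-¬ e′ e)
  ... | no  _  = refl

  inside⁻ : ∀ i → extended i ≡ not d → Σ[ e ∈ p i ≡ b ] q (i , e) ≡ not d
  inside⁻ i h with p i Bool.≟ b
  ... | yes e = e , h
  ... | no  _ = ⊥-elim (Bool.not-¬ {d} refl h)

module _ (F G H : Species) where
  private
    L R : Species
    L = F ⊙ G ⊙ H
    R = F ⊙ (G ⊙ H)

    proj₁∘proj₁-inj : ∀ {A : Set} {p : A → Bool} {b} {q : Σ[ i ∈ A ] p i ≡ b → Bool} {c} →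
                      Inj (λ (x : Σ[ i ∈ _ ] q i ≡ c) → proj₁ (proj₁ x))
    proj₁∘proj₁-inj e = block-≡ (block-≡ e)

    module To (I : FinSet) (p : ∣ I ∣ → Bool) (q : ∣ block I p true ∣ → Bool) where
      -- The labels outside the block carry `H` and must stay out of the part for `F`, hence the
      -- default `false`.
      open Extend p q false public renaming (extended to r)

      s : ∣ block I r false ∣ → Bool
      s = p ∘ proj₁

      F-bij : ∣ block (block I p true) q true ∣ ↔ ∣ block I r true ∣
      F-bij = bijection-over proj₁∘proj₁-inj proj₁-inj
        (λ ((i , e) , e′) → (i , trans (inside (i , e)) e′) , refl)
        (λ (i , e) → let (e₁ , e₂) = inside⁻ i e in ((i , e₁) , e₂) , refl)

      G-bij : ∣ block (block I p true) q false ∣ ↔ ∣ block (block I r false) s true ∣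
      G-bij = bijection-over proj₁∘proj₁-inj proj₁∘proj₁-inj
        (λ ((i , e) , e′) → ((i , trans (inside (i , e)) e′) , e) , refl)
        (λ ((i , e) , e′) → ((i , e′) , trans (sym (inside (i , e′))) e) , refl)

      H-bij : ∣ block I p false ∣ ↔ ∣ block (block I r false) s false ∣
      H-bij = bijection-over proj₁-inj proj₁∘proj₁-inj
        (λ (i , e) → ((i , outside i e) , e) , refl)
        (λ ((i , _) , e) → (i , e) , refl)

    module From (I : FinSet) (r : ∣ I ∣ → Bool) (s : ∣ block I r false ∣ → Bool) where
      -- Here the labels outside the block carry `F`, which belongs to the part for `F ⊙ G`, hence
      -- the default `true`.
      open Extend r s true public renaming (extended to p)

      q : ∣ block I p true ∣ → Bool
      q = r ∘ proj₁

      F-bij : ∣ block I r true ∣ ↔ ∣ block (block I p true) q true ∣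
      F-bij = bijection-over proj₁-inj proj₁∘proj₁-inj
        (λ (i , e) → ((i , outside i e) , e) , refl)
        (λ ((i , _) , e) → (i , e) , refl)

      G-bij : ∣ block (block I r false) s true ∣ ↔ ∣ block (block I p true) q false ∣
      G-bij = bijection-over proj₁∘proj₁-inj proj₁∘proj₁-inj
        (λ ((i , e) , e′) → ((i , trans (inside (i , e)) e′) , e) , refl)
        (λ ((i , e) , e′) → ((i , e′) , trans (sym (inside (i , e′))) e) , refl)

      H-bij : ∣ block (block I r false) s false ∣ ↔ ∣ block I p false ∣
      H-bij = bijection-over proj₁∘proj₁-inj proj₁-inj
        (λ ((i , e) , e′) → (i , trans (inside (i , e)) e′) , refl)
        (λ (i , e) → let (e₁ , e₂) = inside⁻ i e in ((i , e₁) , e₂) , refl)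

    to : ∀ I → Elem (L [ I ]) → Elem (R [ I ])
    to I (p , (q , f , g) , h) =
        r , relabel F {block (block I p true) q true} {block I r true} F-bij f
      , s , relabel G {block (block I p true) q false} {block (block I r false) s true} G-bij g
          , relabel H {block I p false} {block (block I r false) s false} H-bij h
      where open To I p q

    from : ∀ I → Elem (R [ I ]) → Elem (L [ I ])
    from I (r , f , s , g , h) =
        p , (q , relabel F {block I r true} {block (block I p true) q true} F-bij f
               , relabel G {block (block I r false) s true} {block (block I p true) q false} G-bij g)
          , relabel H {block (block I r false) s false} {block I p false} H-bij h
      where open From I r s

    -- The three factors of a triple product with their label sets placed in `U`, a form in which
    -- the bracketing is no longer visible.
    record Parts (U : Set) : Set₁ where
      constructor parts
      field
        {A B C} : FinSet
        a : ∣ A ∣ → U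
        f : Elem (F [ A ])
        b : ∣ B ∣ → U
        g : Elem (G [ B ])
        c : ∣ C ∣ → U
        h : Elem (H [ C ])

    infix 4 _∼_

    _∼_ : ∀ {U} → Parts U → Parts U → Set
    parts {A} {B} {C} a f b g c h ∼ parts {A′} {B′} {C′} a′ f′ b′ g′ c′ h′ =
      Match F {A = A} {A′} a f a′ f′ × Match G {A = B} {B′} b g b′ g′ × Match H {A = C} {C′} c h c′ h′

    ∼-sym : ∀ {U} {P Q : Parts U} → P ∼ Q → Q ∼ P
    ∼-sym (m , n , o) = Match-sym F m , Match-sym G n , Match-sym H o

    ∼-trans : ∀ {U} {P Q R : Parts U} → P ∼ Q → Q ∼ R → P ∼ R
    ∼-trans (m , n , o) (m′ , n′ , o′) = Match-trans F m m′ , Match-trans G n n′ , Match-trans H o o′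

    partsᴸ : ∀ {U} {I} → (∣ I ∣ → U) → Elem (L [ I ]) → Parts U
    partsᴸ {I = I} a (p , (q , f , g) , h) =
      parts {A = block (block I p true) q true} {block (block I p true) q false} {block I p false}
        (a ∘ proj₁ ∘ proj₁) f (a ∘ proj₁ ∘ proj₁) g (a ∘ proj₁) h

    partsᴿ : ∀ {U} {I} → (∣ I ∣ → U) → Elem (R [ I ]) → Parts U
    partsᴿ {I = I} a (r , f , s , g , h) =
      parts {A = block I r true} {block (block I r false) s true} {block (block I r false) s false}
        (a ∘ proj₁) f (a ∘ proj₁ ∘ proj₁) g (a ∘ proj₁ ∘ proj₁) h

    to-∼ : ∀ {U} I (a : ∣ I ∣ → U) s → partsᴸ {I = I} a s ∼ partsᴿ {I = I} a (to I s)
    to-∼ I a (p , (q , f , g) , h) =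
        Match-relabel F F-bij (a ∘ proj₁) f
      , Match-relabel G G-bij (a ∘ proj₁ ∘ proj₁) g
      , Match-relabel H H-bij (a ∘ proj₁ ∘ proj₁) h
      where open To I p q

    from-∼ : ∀ {U} I (a : ∣ I ∣ → U) t → partsᴸ {I = I} a (from I t) ∼ partsᴿ {I = I} a t
    from-∼ I a (r , f , s , g , h) =
        Match-sym F (Match-relabel F F-bij (a ∘ proj₁ ∘ proj₁) f)
      , Match-sym G (Match-relabel G G-bij (a ∘ proj₁ ∘ proj₁) g)
      , Match-sym H (Match-relabel H H-bij (a ∘ proj₁) h)
      where open From I r s

    module _ {U : Set} {I J : FinSet} {a : ∣ I ∣ → U} {b : ∣ J ∣ → U} where
      matchᴸ⁻ : ∀ {s t} → Match L {A = I} {J} a s b t → partsᴸ {I = I} a s ∼ partsᴸ {I = J} b t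
      matchᴸ⁻ m = let (m′ , o) = Match-⊙⁻ (F ⊙ G) H m
                      (m , n)  = Match-⊙⁻ F G m′ in m , n , o

      matchᴿ⁻ : ∀ {s t} → Match R {A = I} {J} a s b t → partsᴿ {I = I} a s ∼ partsᴿ {I = J} b t
      matchᴿ⁻ m = let (m , n′) = Match-⊙⁻ F (G ⊙ H) m
                      (n , o)  = Match-⊙⁻ G H n′ in m , n , o

      module _ (a-inj : Inj a) (b-inj : Inj b) where
        matchᴸ⁺ : ∀ {s t} → partsᴸ {I = I} a s ∼ partsᴸ {I = J} b t → Match L {A = I} {J} a s b t
        matchᴸ⁺ (m , n , o) = Match-⊙⁺ (F ⊙ G) H a-inj b-inj
          (Match-⊙⁺ F G (block-≡ ∘ a-inj) (block-≡ ∘ b-inj) m n) o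

        matchᴿ⁺ : ∀ {s t} → partsᴿ {I = I} a s ∼ partsᴿ {I = J} b t → Match R {A = I} {J} a s b t
        matchᴿ⁺ (m , n , o) = Match-⊙⁺ F (G ⊙ H) a-inj b-inj m
          (Match-⊙⁺ G H (block-≡ ∘ a-inj) (block-≡ ∘ b-inj) n o)

  -- A match in either bracketing amounts to matches of the three parts, and `to` and `from` keep
  -- the parts matched. Equivariance, injectivity and surjectivity are then chains of `∼`.
  ⊙-assoc : F ⊙ G ⊙ H ≅ F ⊙ (G ⊙ H)
  ⊙-assoc = match-iso to
    (λ I J a b a-inj b-inj {s} {t} m → matchᴿ⁺ a-inj b-inj
      (∼-trans (∼-sym (to-∼ I a s)) (∼-trans (matchᴸ⁻ m) (to-∼ J b t))))
    (λ I {s} {t} m → matchᴸ⁺ id id (∼-trans (to-∼ I id s) (∼-trans (matchᴿ⁻ m) (∼-sym (to-∼ I id t)))))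
    (λ I t → from I t , matchᴿ⁺ id id (∼-trans (∼-sym (to-∼ I id (from I t))) (from-∼ I id t)))

⊙-distribʳ : ∀ F G H → (F ⊕ G) ⊙ H ≅ F ⊙ H ⊕ G ⊙ H
⊙-distribʳ F G H = mkIso {(F ⊕ G) ⊙ H} {F ⊙ H ⊕ G ⊙ H} to from
  (λ { I {_ , inj₁ _ , _} {_ , inj₁ _ , _} (e , inj₁ f≈ , h≈) → inj₁ (e , f≈ , h≈)
     ; I {_ , inj₂ _ , _} {_ , inj₂ _ , _} (e , inj₂ g≈ , h≈) → inj₂ (e , g≈ , h≈) })
  (λ { I (inj₁ (e , f≈ , h≈)) → e , inj₁ f≈ , h≈
     ; I (inj₂ (e , g≈ , h≈)) → e , inj₂ g≈ , h≈ })
  (λ { I (inj₁ s) → inj₁ (FinSetoid.refl ((F ⊙ H) [ I ]) {s})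
     ; I (inj₂ s) → inj₂ (FinSetoid.refl ((G ⊙ H) [ I ]) {s}) })
  (λ { I (p , inj₁ f , h) → FinSetoid.refl (((F ⊕ G) ⊙ H) [ I ]) {p , inj₁ f , h}
     ; I (p , inj₂ g , h) → FinSetoid.refl (((F ⊕ G) ⊙ H) [ I ]) {p , inj₂ g , h} })
  (λ { I J φ (p , inj₁ f , h) → inj₁ (FinSetoid.refl ((F ⊙ H) [ J ]) {relabel (F ⊙ H) {I} {J} φ (p , f , h)})
     ; I J φ (p , inj₂ g , h) → inj₂ (FinSetoid.refl ((G ⊙ H) [ J ]) {relabel (G ⊙ H) {I} {J} φ (p , g , h)}) })
  where
  to : ∀ I → Elem (((F ⊕ G) ⊙ H) [ I ]) → Elem ((F ⊙ H ⊕ G ⊙ H) [ I ])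
  to I (p , inj₁ f , h) = inj₁ (p , f , h)
  to I (p , inj₂ g , h) = inj₂ (p , g , h)

  from : ∀ I → Elem ((F ⊙ H ⊕ G ⊙ H) [ I ]) → Elem (((F ⊕ G) ⊙ H) [ I ])
  from I (inj₁ (p , f , h)) = p , inj₁ f , h
  from I (inj₂ (p , g , h)) = p , inj₂ g , h

-- The recursion F ≅ A ⊕ X ⊙ F

-- A solution of F ≅ A ⊕ X ⊙ F is determined on I by its values on smaller label sets.
module Unfold {A F G : Species} (α : F ≅ A ⊕ X ⊙ F) (β : G ≅ A ⊕ X ⊙ G) where
  private
    module α = _≅_ α
    module β = _≅_ (≅-sym β)
    AF AG : Species
    AF = A ⊕ X ⊙ F
    AG = A ⊕ X ⊙ G

  block-< : ∀ {n} I {p} → Elem (X [ block I p true ]) → size I < suc n → size (block I p false) < n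
  block-< I {p} ((_ , e) , _) (s≤s h) = ℕ.<-≤-trans (block-size-< I p e) h

  mutual
    -- `n` is fuel exceeding the size of `I`. The `X` factor uses up a label, so one unit less
    -- suffices for the remaining block.
    to : ∀ n I → size I < n → Elem (F [ I ]) → Elem (G [ I ])
    to (suc n) I h f = Inverse.to (β.iso I) (step n I h (Inverse.to (α.iso I) f))

    step : ∀ n I → size I < suc n → Elem (AF [ I ]) → Elem (AG [ I ])
    step n I h (inj₁ a)           = inj₁ a
    step n I h (inj₂ (p , x , f)) = inj₂ (p , x , to n (block I p false) (block-< I x h) f)

  mutual
    -- Two independent fuels are needed: `size` measures an enumeration that may repeat labels, so
    -- sets in bijection can differ in size. At the identity the statement also shows that the
    -- choice of fuel is immaterial.
    to-equivariant : ∀ n m I J h h′ (φ : ∣ I ∣ ↔ ∣ J ∣) {s t} →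
      FinSetoid._≈_ (F [ J ]) (relabel F {I} {J} φ s) t →
      FinSetoid._≈_ (G [ J ]) (relabel G {I} {J} φ (to n I h s)) (to m J h′ t)
    to-equivariant (suc n) (suc m) I J h h′ φ {s} e = FinSetoid.trans (G [ J ])
      (FinSetoid.sym (G [ J ]) (β.natural {I} {J} φ _))
      (Inverse.to-cong (β.iso J) (step-equivariant n m I J h h′ φ {Inverse.to (α.iso I) s}
        (FinSetoid.trans (AF [ J ]) (FinSetoid.sym (AF [ J ]) (α.natural {I} {J} φ s)) (Inverse.to-cong (α.iso J) e))))

    step-equivariant : ∀ n m I J h h′ (φ : ∣ I ∣ ↔ ∣ J ∣) {s t} →
      FinSetoid._≈_ (AF [ J ]) (relabel AF {I} {J} φ s) t →
      FinSetoid._≈_ (AG [ J ]) (relabel AG {I} {J} φ (step n I h s)) (step m J h′ t)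
    step-equivariant n m I J h h′ φ {inj₁ _} {inj₁ _} (inj₁ e) = inj₁ e
    step-equivariant n m I J h h′ φ {inj₂ (p , x , f)} {inj₂ (q , y , g)} (inj₂ (e , _ , f≈)) =
      -- The tail goes from `P` to `P′` along `φ` and on to `Q` along `e`; the induction hypothesis
      -- is used once for each leg.
      inj₂ (e , tt , FinSetoid.trans (G [ Q ])
        (Species.relabel-resp G {P′} {Q} (restrict (↔-id _) e false) (restrict (↔-id _) e false) (λ _ → refl)
          (to-equivariant n m P P′ _ hP′ (restrict φ _ false) (FinSetoid.refl (F [ P′ ]))))
        (to-equivariant m m P′ Q hP′ _ (restrict (↔-id _) e false) f≈))
      where
      P P′ Q : FinSet
      P  = block I p false
      P′ = block J (p ∘ Inverse.from φ) false
      Q  = block J q false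

      hP′ : size P′ < m
      hP′ = block-< J (moveBlock X I J φ p true x) h′

module _ {A F G : Species} (α : F ≅ A ⊕ X ⊙ F) (β : G ≅ A ⊕ X ⊙ G) where
  private
    module α = _≅_ α
    module β = _≅_ β
    module U = Unfold α β
    module V = Unfold β α
    AF AG : Species
    AF = A ⊕ X ⊙ F
    AG = A ⊕ X ⊙ G

  -- The isomorphism `β` cancels in the middle, and the two remaining `step`s are inverse by
  -- induction on the fuel.
  unfold-inverse : ∀ n I h s → FinSetoid._≈_ (F [ I ]) (V.to n I h (U.to n I h s)) s
  unfold-inverse (suc n) I h s = FinSetoid.trans (F [ I ])
    (Inverse.from-cong (α.iso I) (FinSetoid.trans (AF [ I ])
      (step-cong (Inverse.strictlyInverseˡ (β.iso I) (U.step n I h u))) (step-inverse u)))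
    (Inverse.strictlyInverseʳ (α.iso I) s)
    where
    u : Elem (AF [ I ])
    u = Inverse.to (α.iso I) s

    step-cong : ∀ {s t} → FinSetoid._≈_ (AG [ I ]) s t → FinSetoid._≈_ (AF [ I ]) (V.step n I h s) (V.step n I h t)
    step-cong {s} {t} e = FinSetoid.trans (AF [ I ])
      (FinSetoid.sym (AF [ I ]) (Species.relabel-id AF {I} _))
      (V.step-equivariant n n I I h h (↔-id _) {s} {t} (FinSetoid.trans (AG [ I ]) (Species.relabel-id AG {I} s) e))

    step-inverse : ∀ u → FinSetoid._≈_ (AF [ I ]) (V.step n I h (U.step n I h u)) u
    step-inverse (inj₁ a)           = inj₁ (FinSetoid.refl (A [ I ]))
    step-inverse (inj₂ (p , x , f)) = inj₂ ((λ _ → refl) , tt , FinSetoid.trans (F [ block I p false ])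
      (Transport.transport-refl F I _ false _) (unfold-inverse n (block I p false) _ f))

X-recursion-unique : ∀ {A F G} → F ≅ A ⊕ X ⊙ F → G ≅ A ⊕ X ⊙ G → F ≅ G
X-recursion-unique {A} {F} {G} α β = mkIso {F} {G} (λ I → U.to _ I ℕ.≤-refl) (λ I → V.to _ I ℕ.≤-refl)
  (λ I {s} e → FinSetoid.trans (G [ I ]) (FinSetoid.sym (G [ I ]) (Species.relabel-id G {I} _))
    (U.to-equivariant _ _ I I _ _ (↔-id _) (FinSetoid.trans (F [ I ]) (Species.relabel-id F {I} s) e)))
  (λ I {s} e → FinSetoid.trans (F [ I ]) (FinSetoid.sym (F [ I ]) (Species.relabel-id F {I} _))
    (V.to-equivariant _ _ I I _ _ (↔-id _) (FinSetoid.trans (G [ I ]) (Species.relabel-id G {I} s) e)))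
  (λ I → unfold-inverse β α _ I ℕ.≤-refl)
  (λ I → unfold-inverse α β _ I ℕ.≤-refl)
  (λ I J φ s → FinSetoid.sym (G [ J ]) (U.to-equivariant _ _ I J _ _ φ (FinSetoid.refl (F [ J ]))))
  where
  module U = Unfold α β
  module V = Unfold β α

-- Split partitions and swing vertices

-- Split partitions as a single equation: distinct vertices on one side are adjacent exactly when
-- that side is the clique. Both sides are thereby treated alike.
Partition : ∀ {I} → Graph I → (I → Bool) → Set
Partition g K = ∀ i j → i ≢ j → K i ≡ K j → adj g i j ≡ K i

-- v is a swing vertex: there are split partitions with v on either side.
Swing : ∀ {I} → Graph I → I → Set
Swing g v = Partition g (adj g v)

split⇒partition : ∀ {I} {g : Graph I} {K} → IsSplitPartition g K → Partition g K
split⇒partition {K = K} (clique , stable) i j i≢j e with K i in Ki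
... | true  = clique i j Ki (sym e) i≢j
... | false = stable i j (cong not Ki) (cong not (sym e))

pull-partition : ∀ {I J} {g : Graph I} {h : Graph J} {K L} (f : I → J) → Inj f →
  (∀ i j → adj g i j ≡ adj h (f i) (f j)) → (∀ i → K i ≡ L (f i)) → Partition h L → Partition g K
pull-partition f f-inj g≈h K≈L P i j i≢j e = trans (g≈h i j)
  (trans (P _ _ (i≢j ∘ f-inj) (trans (sym (K≈L i)) (trans e (K≈L j)))) (sym (K≈L i)))

pull-swing : ∀ {I J} {g : Graph I} {h : Graph J} (f : I → J) → Inj f →
  (∀ i j → adj g i j ≡ adj h (f i) (f j)) → ∀ v → Swing h (f v) → Swing g v
pull-swing {g = g} {h} f f-inj g≈h v = pull-partition {g = g} {h} {adj g v} {adj h (f v)} f f-inj g≈h (g≈h v)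

no-three : ∀ {a b c : Bool} → a ≢ b → c ≢ a → ¬ c ≢ b
no-three a≢b c≢a c≢b = a≢b (Bool.not-injective (trans (sym (Bool.¬-not c≢a)) (Bool.¬-not c≢b)))

module SplitPartitions (I : FinSet) where
  open FinSet I using (_≟_)

  partition⇒split : ∀ {g : Graph ∣ I ∣} {K} → Partition g K → IsSplitPartition g K
  partition⇒split {g} {K} P = clique , stable
    where
    clique : IsClique g K
    clique i j Ki Kj i≢j = trans (P i j i≢j (trans Ki (sym Kj))) Ki

    stable : IsStable g (not ∘ K)
    stable i j Ki Kj with i ≟ j
    ... | yes refl = loopless g i
    ... | no i≢j   = trans (P i j i≢j (Bool.not-injective (trans Ki (sym Kj)))) (Bool.not-injective Ki)

  module _ (g : Graph ∣ I ∣) where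
    SwingClique : Set
    SwingClique = ∀ i j → Swing g i → Swing g j → i ≢ j → adj g i j ≡ true

    abstract
      swing? : ∀ v → Dec (Swing g v)
      swing? v = all? I λ i → all? I λ j →
        ¬? (i ≟ j) →-dec ((adj g v i Bool.≟ adj g v j) →-dec (adj g i j Bool.≟ adj g v i))

      swingClique? : Dec SwingClique
      swingClique? = all? I λ i → all? I λ j →
        swing? i →-dec (swing? j →-dec (¬? (i ≟ j) →-dec (adj g i j Bool.≟ true)))

    -- The split partition with all swing vertices on the same side; where there
    -- is a single one, in the clique.
    default : (∣ I ∣ → Bool) → ∣ I ∣ → Bool
    default K i = if does (swing? i) then does swingClique? else K i

  flip : ∣ I ∣ → (∣ I ∣ → Bool) → ∣ I ∣ → Bool
  flip v K i = does (i ≟ v) xor K i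

  flip-at : ∀ v K → flip v K v ≡ not (K v)
  flip-at v K rewrite dec-true (v ≟ v) refl = refl

  flip-off : ∀ {v} K {i} → i ≢ v → flip v K i ≡ K i
  flip-off {v} K {i} i≢v rewrite dec-false (i ≟ v) i≢v = refl

  module _ {g : Graph ∣ I ∣} where
    -- If `i` is in the clique, its non-neighbours other than itself are in the stable set; if `i`
    -- is in the stable set, its neighbours are in the clique. So `x` and `y`, when distinct from
    -- `i`, lie on a common side, which fixes their adjacency.
    opposite-uniform : ∀ {K i x y} → Partition g K → K i ≡ not (adj g i x) → x ≢ y →
                       adj g i x ≡ adj g i y → adj g x y ≡ adj g i x
    opposite-uniform {K} {i} {x} {y} P Ki x≢y e with x ≟ i | y ≟ i
    ... | yes refl | _        = sym e
    ... | no _     | yes refl = symmetric g x y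
    ... | no x≢i   | no y≢i   = trans (P x y x≢y (trans Kx (sym (side y≢i (sym e))))) Kx
      where
      side : ∀ {z} → z ≢ i → adj g i z ≡ adj g i x → K z ≡ adj g i x
      side {z} z≢i e′ = trans (Bool.¬-not (λ Kz → Bool.not-¬ {adj g i x} refl
        (trans (sym e′) (trans (P i z (z≢i ∘ sym) (trans Ki (sym Kz))) Ki)))) (Bool.not-involutive _)

      Kx : K x ≡ adj g i x
      Kx = side x≢i refl

    -- For each `x`, one of `K i` and `L i` is the negation of `adj g i x`, and `opposite-uniform`
    -- applies to that partition.
    differ⇒swing : ∀ {K L i} → Partition g K → Partition g L → K i ≢ L i → Swing g i
    differ⇒swing {K} {L} {i} P Q Ki≢Li x y x≢y e with K i Bool.≟ adj g i x
    ... | no Ki  = opposite-uniform P (Bool.¬-not Ki) x≢y e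
    ... | yes Ki = opposite-uniform Q (Bool.¬-not λ Li → Ki≢Li (trans Ki (sym Li))) x≢y e

    -- If `adj g x y` and `adj g x z` differed, `adj g y z` could equal neither: the swing property
    -- at `y` excludes the first and that at `z` the second.
    swing-uniform : ∀ {x y z} → Swing g x → Swing g y → Swing g z → x ≢ y → x ≢ z → adj g x y ≡ adj g x z
    swing-uniform {x} {y} {z} sx sy sz x≢y x≢z with y ≟ z | adj g x y Bool.≟ adj g x z
    ... | yes refl | _      = refl
    ... | no _     | yes e  = e
    ... | no y≢z   | no a≢b = ⊥-elim (no-three a≢b
      (λ c≡a → a≢b (sym (trans (sy x z x≢z (trans (symmetric g y x) (sym c≡a))) (symmetric g y x))))
      (λ c≡b → a≢b (trans (sz x y x≢y (trans (symmetric g z x) (trans (sym c≡b) (symmetric g y z)))) (symmetric g z x))))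

    swing-edges : ∀ {i j k l} → Swing g i → Swing g j → Swing g k → Swing g l → i ≢ j → k ≢ l →
                  adj g i j ≡ adj g k l
    swing-edges {i} {j} {k} {l} si sj sk sl i≢j k≢l with i ≟ k
    ... | yes refl = swing-uniform si sj sl i≢j k≢l
    ... | no i≢k   = trans (swing-uniform si sj sk i≢j i≢k)
                    (trans (symmetric g i k) (swing-uniform sk si sl (i≢k ∘ sym) k≢l))

    -- All pairs of distinct swing vertices have the same adjacency, so a single edge already makes
    -- them a clique.
    swing-edge : ∀ {i j} → Swing g i → Swing g j → i ≢ j → adj g i j ≡ does (swingClique? g)
    swing-edge {i} {j} si sj i≢j with swingClique? g
    ... | yes c = c i j si sj i≢j
    ... | no ¬c = Bool.¬-not λ e → ¬c λ k l sk sl k≢l → trans (swing-edges sk sl si sj k≢l i≢j) e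

    default-swing : ∀ K {i} → Swing g i → default g K i ≡ does (swingClique? g)
    default-swing K {i} si rewrite dec-true (swing? g i) si = refl

    default-nonswing : ∀ K {i} → ¬ Swing g i → default g K i ≡ K i
    default-nonswing K {i} ¬si rewrite dec-false (swing? g i) ¬si = refl

    nonswing-agree : ∀ {K L i} → Partition g K → Partition g L → ¬ Swing g i → K i ≡ L i
    nonswing-agree {K} {L} {i} P Q ¬si = decidable-stable (K i Bool.≟ L i) (¬si ∘ differ⇒swing P Q)

    -- Only pairs of swing vertices need checking. For a swing vertex `i` and another vertex `j`
    -- that is not one, the neighbourhood of `i` is a split partition and hence agrees with `K` at
    -- `j`.
    partition-by-swings : ∀ {K L} → Partition g K → (∀ i → ¬ Swing g i → L i ≡ K i) →
      (∀ i j → Swing g i → Swing g j → i ≢ j → L i ≡ L j → adj g i j ≡ L i) → Partition g L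
    partition-by-swings P off on i j i≢j e with swing? g i | swing? g j
    ... | yes si | yes sj = on i j si sj i≢j e
    ... | yes si | no ¬sj = trans (nonswing-agree si P ¬sj) (trans (sym (off j ¬sj)) (sym e))
    ... | no ¬si | yes sj = trans (symmetric g i j) (trans (nonswing-agree sj P ¬si) (sym (off i ¬si)))
    ... | no ¬si | no ¬sj = trans (P i j i≢j (trans (sym (off i ¬si)) (trans e (off j ¬sj)))) (sym (off i ¬si))

    module _ {K} (P : Partition g K) where
      private
        D : ∣ I ∣ → Bool
        D = default g K

      default-partition : Partition g D
      default-partition = partition-by-swings P (λ _ → default-nonswing K)
        (λ i j si sj i≢j _ → trans (swing-edge si sj i≢j) (sym (default-swing K si)))

      -- `D` has all swing vertices on one side. After the flip `v` shares its side with no other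
      -- swing vertex, so every pair still to be checked avoids `v`.
      flip-partition : ∀ {v} → Swing g v → Partition g (flip v D)
      flip-partition {v} sv = partition-by-swings P
        (λ i ¬si → trans (flip-off D (λ { refl → ¬si sv })) (default-nonswing K ¬si)) on
        where
        on : ∀ i j → Swing g i → Swing g j → i ≢ j → flip v D i ≡ flip v D j → adj g i j ≡ flip v D i
        on i j si sj i≢j e with i ≟ v | j ≟ v
        ... | yes refl | yes refl = ⊥-elim (i≢j refl)
        ... | yes refl | no _     = ⊥-elim (Bool.not-¬ (trans (default-swing K sj) (sym (default-swing K si))) (sym e))
        ... | no _     | yes refl = ⊥-elim (Bool.not-¬ (trans (default-swing K si) (sym (default-swing K sj))) e)
        ... | no _     | no _     = trans (swing-edge si sj i≢j) (sym (default-swing K si))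

      deviates⇒swing : ∀ {v} → K v ≢ D v → Swing g v
      deviates⇒swing = differ⇒swing P default-partition

      -- Two deviating vertices would lie on a common side in `D` and on a common, opposite side in
      -- `K`, and the two partitions would contradict each other about their adjacency.
      deviation-unique : ∀ {v w} → K v ≢ D v → K w ≢ D w → v ≡ w
      deviation-unique {v} {w} v≢ w≢ = decidable-stable (v ≟ w) λ v≢w →
        v≢ (trans (sym (P v w v≢w K-eq)) (default-partition v w v≢w D-eq))
        where
        D-eq : D v ≡ D w
        D-eq = trans (default-swing K (deviates⇒swing v≢)) (sym (default-swing K (deviates⇒swing w≢)))

        K-eq : K v ≡ K w
        K-eq = trans (Bool.¬-not v≢) (trans (cong not D-eq) (sym (Bool.¬-not w≢)))

      deviates⇒flip : ∀ {v} → K v ≢ D v → ∀ i → flip v D i ≡ K i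
      deviates⇒flip {v} v≢ i with i ≟ v
      ... | yes refl = sym (Bool.¬-not v≢)
      ... | no i≢v   = sym (decidable-stable (K i Bool.≟ D i) (λ i≢ → i≢v (deviation-unique i≢ v≢)))

-- Invariance of the default partition

module _ (I J : FinSet) (φ : ∣ I ∣ ↔ ∣ J ∣) {g : Graph ∣ I ∣} {h : Graph ∣ J ∣}
         (g≈h : ∀ i j → adj g i j ≡ adj h (Inverse.to φ i) (Inverse.to φ j)) where
  private
    module I = SplitPartitions I
    module J = SplitPartitions J
    module φ = Inverse φ

    h≈g : ∀ i j → adj h i j ≡ adj g (φ.from i) (φ.from j)
    h≈g i j = sym (trans (g≈h _ _) (cong₂ (adj h) (φ.strictlyInverseˡ i) (φ.strictlyInverseˡ j)))

    swing⁺ : ∀ i → Swing g (φ.from i) → Swing h i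
    swing⁺ = pull-swing {g = h} {g} φ.from (↔-inj (↔-sym φ)) h≈g

    swing⁻ : ∀ i → Swing h (φ.to i) → Swing g i
    swing⁻ = pull-swing {g = g} {h} φ.to (↔-inj φ) g≈h

    swing⁺′ : ∀ i → Swing g i → Swing h (φ.to i)
    swing⁺′ i s = swing⁺ _ (subst (Swing g) (sym (φ.strictlyInverseʳ i)) s)

    swingClique-invariant : does (I.swingClique? g) ≡ does (J.swingClique? h)
    swingClique-invariant = does-⇔ (mk⇔
      (λ c i j si sj i≢j → trans (h≈g i j) (c _ _ (swing⁻′ i si) (swing⁻′ j sj) (i≢j ∘ ↔-inj (↔-sym φ))))
      (λ c i j si sj i≢j → trans (g≈h i j) (c _ _ (swing⁺′ i si) (swing⁺′ j sj) (i≢j ∘ ↔-inj φ))))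
      (I.swingClique? g) (J.swingClique? h)
      where
      swing⁻′ : ∀ i → Swing h i → Swing g (φ.from i)
      swing⁻′ i s = swing⁻ _ (subst (Swing h) (sym (φ.strictlyInverseˡ i)) s)

  -- `K` and `L` need not correspond: the default depends on the graph alone, because all split
  -- partitions agree off the swing vertices.
  default-invariant : ∀ {K L} → Partition g K → Partition h L → ∀ i → I.default g K i ≡ J.default h L (φ.to i)
  default-invariant {K} {L} P Q i with I.swing? g i
  ... | yes si = trans swingClique-invariant (sym (J.default-swing {h} L (swing⁺′ i si)))
  ... | no ¬si = trans (I.nonswing-agree {g} {K} {L ∘ φ.to} P
                         (pull-partition {g = g} {h} {L ∘ φ.to} {L} φ.to (↔-inj φ) g≈h (λ _ → refl) Q) ¬si)
                       (sym (J.default-nonswing {h} L (¬si ∘ swing⁻ i)))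

-- Bicolored graphs as partitioned split graphs

isGreen : Color → Bool
isGreen green = true
isGreen red   = false

isGreen-inj : Inj isGreen
isGreen-inj {green} {green} _ = refl
isGreen-inj {red}   {red}   _ = refl

colorOf : Bool → Color
colorOf true  = green
colorOf false = red

isGreen-colorOf : ∀ b → isGreen (colorOf b) ≡ b
isGreen-colorOf true  = refl
isGreen-colorOf false = refl

colorOf-inj : Inj colorOf
colorOf-inj {a} {b} e = trans (sym (isGreen-colorOf a)) (trans (cong isGreen e) (isGreen-colorOf b))

xor-≡ : ∀ {a b} → a ≡ b → a xor b ≡ false
xor-≡ {a} refl = Bool.xor-same a

xor-≢ : ∀ {a b} → a ≢ b → a xor b ≡ true
xor-≢ {true}  {true}  ne = ⊥-elim (ne refl)
xor-≢ {true}  {false} _  = refl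
xor-≢ {false} {true}  _  = refl
xor-≢ {false} {false} ne = ⊥-elim (ne refl)

∧-≢ : ∀ {a b} → a ≢ b → a ∧ b ≡ false
∧-≢ {true}  {true}  ne = ⊥-elim (ne refl)
∧-≢ {true}  {false} _  = refl
∧-≢ {false} {_}     _  = refl

greens : ∀ {I} → BicoloredGraph I → I → Bool
greens b = isGreen ∘ BicoloredGraph.color b

edge : ∀ {I} → BicoloredGraph I → I → I → Bool
edge b = adj (BicoloredGraph.graph b)

same-color-edge : ∀ {I} (b : BicoloredGraph I) {i j} → greens b i ≡ greens b j → edge b i j ≡ false
same-color-edge b {i} {j} e = Bool.¬-not λ a → BicoloredGraph.proper b i j a (isGreen-inj e)

-- The `xor` keeps only edges between the two sides. On split partitions this is inverse to `fill`,
-- with the clique becoming green.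
strip : ∀ {I} → Graph I → (I → Bool) → BicoloredGraph I
strip g K = record
  { graph = record
    { adj       = λ i j → adj g i j ∧ (K i xor K j)
    ; symmetric = λ i j → cong₂ _∧_ (symmetric g i j) (Bool.xor-comm (K i) (K j))
    ; loopless  = λ i → cong (_∧ (K i xor K i)) (loopless g i)
    }
  ; color  = colorOf ∘ K
  ; proper = λ i j a c → Bool.not-¬ {true} refl (trans (sym a)
      (trans (cong (adj g i j ∧_) (xor-≡ (colorOf-inj c))) (Bool.∧-zeroʳ _)))
  }

strip-≢ : ∀ {I} (g : Graph I) K {i j} → K i ≢ K j → edge (strip g K) i j ≡ adj g i j
strip-≢ g K {i} {j} ne = trans (cong (adj g i j ∧_) (xor-≢ ne)) (Bool.∧-identityʳ _)

strip-equivariant : ∀ {I J} (φ : I ↔ J) {g : Graph I} {h : Graph J} {K L} →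
  (∀ i j → adj g i j ≡ adj h (Inverse.to φ i) (Inverse.to φ j)) → (∀ i → K i ≡ L (Inverse.to φ i)) →
  (∀ i j → edge (strip g K) (Inverse.from φ i) (Inverse.from φ j) ≡ edge (strip h L) i j) ×
  (∀ i → colorOf (K (Inverse.from φ i)) ≡ colorOf (L i))
strip-equivariant φ {g} {h} {K} {L} g≈h K≈L =
    (λ i j → cong₂ _∧_ (trans (g≈h _ _) (cong₂ (adj h) (φ.strictlyInverseˡ i) (φ.strictlyInverseˡ j)))
                       (cong₂ _xor_ (K≈L′ i) (K≈L′ j)))
  , (λ i → cong colorOf (K≈L′ i))
  where
  module φ = Inverse φ

  K≈L′ : ∀ i → K (φ.from i) ≡ L i
  K≈L′ i = trans (K≈L _) (cong L (φ.strictlyInverseˡ i))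

module Fill (I : FinSet) where
  open FinSet I using (_≟_)

  fill : BicoloredGraph ∣ I ∣ → Graph ∣ I ∣
  fill b = record
    { adj       = λ i j → edge b i j ∨ ((greens b i ∧ greens b j) ∧ not (does (i ≟ j)))
    ; symmetric = λ i j → cong₂ _∨_ (symmetric (BicoloredGraph.graph b) i j)
        (cong₂ _∧_ (Bool.∧-comm (greens b i) (greens b j)) (cong not (does-⇔ (mk⇔ sym sym) (i ≟ j) (j ≟ i))))
    ; loopless  = λ i → cong₂ _∨_ (loopless (BicoloredGraph.graph b) i)
        (trans (cong (λ d → (greens b i ∧ greens b i) ∧ not d) (dec-true (i ≟ i) refl)) (Bool.∧-zeroʳ _))
    }

  fill-partition : ∀ b → Partition (fill b) (greens b)
  fill-partition b i j i≢j e rewrite same-color-edge b e | dec-false (i ≟ j) i≢j | sym e =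
    trans (Bool.∧-identityʳ _) (Bool.∧-idem _)

  fill-≢ : ∀ b {i j} → greens b i ≢ greens b j → adj (fill b) i j ≡ edge b i j
  fill-≢ b {i} {j} ne rewrite ∧-≢ ne = Bool.∨-identityʳ _

  fill-strip : ∀ {g K} → Partition g K → ∀ i j → adj (fill (strip g K)) i j ≡ adj g i j
  fill-strip {g} {K} P i j with i ≟ j
  ... | yes refl = trans (cong₂ _∨_ (loopless (BicoloredGraph.graph (strip g K)) i) (Bool.∧-zeroʳ _)) (sym (loopless g i))
  -- The goal has the decision already evaluated, while `≢-case` is stated with `i ≟ j` open;
  -- `dec-false` links the two.
  ... | no i≢j   = subst (λ d → edge s i j ∨ ((greens s i ∧ greens s j) ∧ not d) ≡ adj g i j)
                         (dec-false (i ≟ j) i≢j) ≢-case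
    where
    s : BicoloredGraph ∣ I ∣
    s = strip g K

    ≢-case : adj (fill s) i j ≡ adj g i j
    ≢-case with K i Bool.≟ K j
    ... | no ne = trans (fill-≢ s (ne ∘ colorOf-inj ∘ isGreen-inj)) (strip-≢ g K ne)
    ... | yes e = trans (fill-partition s i j i≢j (cong (isGreen ∘ colorOf) e))
                        (trans (isGreen-colorOf (K i)) (sym (P i j i≢j e)))

  strip-fill : ∀ b i j → edge (strip (fill b) (greens b)) i j ≡ edge b i j
  strip-fill b i j with greens b i Bool.≟ greens b j
  ... | no ne = trans (strip-≢ (fill b) (greens b) ne) (fill-≢ b ne)
  ... | yes e = trans (cong (adj (fill b) i j ∧_) (xor-≡ e))
      (trans (Bool.∧-zeroʳ _) (sym (same-color-edge b e)))

fill-cong : ∀ I J {b : BicoloredGraph ∣ I ∣} {c : BicoloredGraph ∣ J ∣} (f : ∣ I ∣ → ∣ J ∣) → Inj f →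
  (∀ i j → edge b i j ≡ edge c (f i) (f j)) → (∀ i → greens b i ≡ greens c (f i)) →
  ∀ i j → adj (Fill.fill I b) i j ≡ adj (Fill.fill J c) (f i) (f j)
fill-cong I J f f-inj e k i j = cong₂ _∨_ (e i j) (cong₂ _∧_ (cong₂ _∧_ (k i) (k j))
  (cong not (does-⇔ (mk⇔ (cong f) f-inj) (FinSet._≟_ I i j) (FinSet._≟_ J (f i) (f j)))))

-- The recursion for bicolored graphs

pull : ∀ {I J} → (I → J) → Graph J → Graph I
pull f g = record
  { adj       = λ i j → adj g (f i) (f j)
  ; symmetric = λ i j → symmetric g (f i) (f j)
  ; loopless  = λ i → loopless g (f i)
  }

coneᴹ : ∀ {B} → Graph B → (B → Bool) → Graph (Maybe B)
coneᴹ h K = record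
  { adj       = λ { nothing nothing → false ; nothing (just j) → K j
                  ; (just i) nothing → K i ; (just i) (just j) → adj h i j }
  ; symmetric = λ { nothing nothing → refl ; nothing (just j) → refl
                  ; (just i) nothing → refl ; (just i) (just j) → symmetric h i j }
  ; loopless  = λ { nothing → refl ; (just i) → loopless h i }
  }

dichotomy : ∀ b → b ≡ true ⊎ b ≡ false
dichotomy true  = inj₁ refl
dichotomy false = inj₂ refl

-- The graph h on { i | p i ≡ false } with the remaining vertices joined to K.
module Cone {I : Set} (p : I → Bool) (h : Graph (Σ[ i ∈ I ] p i ≡ false)) (K : Σ[ i ∈ I ] p i ≡ false → Bool) where
  locate : I → Maybe (Σ[ i ∈ I ] p i ≡ false)
  locate i with p i Bool.≟ false
  ... | yes e = just (i , e)
  ... | no _  = nothing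

  locate-just : ∀ i → locate (proj₁ i) ≡ just i
  locate-just (i , e) with p i Bool.≟ false
  ... | yes _ = cong just (block-≡ refl)
  ... | no ¬e = ⊥-elim (¬e e)

  locate-nothing : ∀ {i} → p i ≡ true → locate i ≡ nothing
  locate-nothing {i} e with p i Bool.≟ false
  ... | yes e′ = ⊥-elim (Bool.not-¬ e e′)
  ... | no _   = refl

  cone : Graph I
  cone = pull locate (coneᴹ h K)

  cone-apex : ∀ {v} → p v ≡ true → ∀ j → adj cone v (proj₁ j) ≡ K j
  cone-apex e j = cong₂ (adj (coneᴹ h K)) (locate-nothing e) (locate-just j)

  cone-base : ∀ i j → adj cone (proj₁ i) (proj₁ j) ≡ adj h i j
  cone-base i j = cong₂ (adj (coneᴹ h K)) (locate-just i) (locate-just j)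

  module _ {v : I} (v∈ : p v ≡ true) (unique : ∀ i → p i ≡ true → v ≡ i) where
    -- As `v` is the only apex, a comparison with `g` reduces to pairs inside the base and pairs of
    -- `v` with a base vertex.
    cone-universal : ∀ {J} {g : Graph J} (f : I → J) → (∀ j → adj g (f v) (f (proj₁ j)) ≡ K j) →
      (∀ i j → adj g (f (proj₁ i)) (f (proj₁ j)) ≡ adj h i j) → ∀ i j → adj cone i j ≡ adj g (f i) (f j)
    cone-universal {g = g} f apex base i j with dichotomy (p i) | dichotomy (p j)
    ... | inj₂ ei | inj₂ ej = trans (cone-base (i , ei) (j , ej)) (sym (base (i , ei) (j , ej)))
    ... | inj₁ ei | inj₂ ej with refl ← unique i ei = trans (cone-apex v∈ (j , ej)) (sym (apex (j , ej)))
    ... | inj₂ ei | inj₁ ej with refl ← unique j ej =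
      trans (symmetric cone i v) (trans (cone-apex v∈ (i , ei)) (trans (sym (apex (i , ei))) (symmetric g _ _)))
    ... | inj₁ ei | inj₁ ej with refl ← unique i ei | refl ← unique j ej =
      trans (loopless cone v) (sym (loopless g (f v)))

    -- On the base the neighbourhood of `v` is `K`, so `P` handles base pairs; pairs containing `v`
    -- hold by symmetry of adjacency.
    cone-swing : Partition h K → Swing cone v
    cone-swing P i j i≢j e with dichotomy (p i) | dichotomy (p j)
    ... | inj₁ ei | _ with refl ← unique i ei = sym e
    ... | inj₂ _  | inj₁ ej with refl ← unique j ej = symmetric cone i v
    ... | inj₂ ei | inj₂ ej = trans (cone-base i′ j′) (trans
      (P i′ j′ (i≢j ∘ cong proj₁) (trans (sym (cone-apex v∈ i′)) (trans e (cone-apex v∈ j′))))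
      (sym (cone-apex v∈ i′)))
      where
      i′ j′ : Σ[ i ∈ I ] p i ≡ false
      i′ = i , ei
      j′ = j , ej

search : ∀ I {P : ∣ I ∣ → Set} → (∀ i → Dec (P i)) → (∀ i → P i) ⊎ ∃[ i ] ¬ P i
search I P? with all? I P?
... | yes ps = inj₁ ps
... | no ¬ps = inj₂ (Any.satisfied (All.¬All⇒Any¬ P? (FinSet.elements I)
  (λ ps → ¬ps (λ i → All.lookup ps (FinSet.complete I i)))))

strip-injective : ∀ I {g h : Graph ∣ I ∣} {K L} → Partition g K → Partition h L →
  (∀ i j → edge (strip g K) i j ≡ edge (strip h L) i j) → (∀ i → colorOf (K i) ≡ colorOf (L i)) →
  (∀ i j → adj g i j ≡ adj h i j) × (∀ i → K i ≡ L i)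
strip-injective I {g} {h} {K} {L} P Q e c =
    (λ i j → trans (sym (fill-strip {g} {K} P i j)) (trans
      (fill-cong I I {strip g K} {strip h L} id id e (cong isGreen ∘ c) i j) (fill-strip {h} {L} Q i j)))
  , colorOf-inj ∘ c
  where open Fill I

fill-injective : ∀ I J {b : BicoloredGraph ∣ I ∣} {c : BicoloredGraph ∣ J ∣} (f : ∣ I ∣ → ∣ J ∣) →
  (∀ i j → adj (Fill.fill I b) i j ≡ adj (Fill.fill J c) (f i) (f j)) → (∀ i → greens b i ≡ greens c (f i)) →
  ∀ i j → edge b i j ≡ edge c (f i) (f j)
fill-injective I J {b} {c} f e k i j = trans (sym (Fill.strip-fill I b i j))
  (trans (cong₂ _∧_ (e i j) (cong₂ _xor_ (k i) (k j))) (Fill.strip-fill J c (f i) (f j)))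

-- The encoding of split graphs and pointed bicolored graphs

module Encode (I : FinSet) where
  open FinSet I using (_≟_)
  open SplitPartitions I

  -- Joining the new vertex to exactly the clique of the filled smaller graph makes it a swing
  -- vertex.
  underlying : Elem ((Split ⊕ X ⊙ BC) [ I ]) → Graph ∣ I ∣
  underlying (inj₁ s)           = SplitGraph.graph s
  underlying (inj₂ (p , x , b)) = Cone.cone p (Fill.fill (block I p false) b) (greens b)

  apex : Elem ((X ⊙ BC) [ I ]) → ∣ I ∣
  apex (p , ((v , _) , _) , b) = v

  module _ (p : ∣ I ∣ → Bool) (x : Elem (X [ block I p true ])) where
    apex-unique : ∀ i → p i ≡ true → proj₁ (proj₁ x) ≡ i
    apex-unique i e = cong proj₁ (proj₂ x (i , e))

    p-apex : ∀ i → p i ≡ does (i ≟ proj₁ (proj₁ x))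
    p-apex i with i ≟ proj₁ (proj₁ x)
    ... | yes refl = proj₂ (proj₁ x)
    ... | no i≢v   = Bool.¬-not (λ e → i≢v (sym (apex-unique i e)))

  apex-swing : ∀ s → Swing (underlying (inj₂ s)) (apex s)
  apex-swing (p , x , b) = Cone.cone-swing p _ _ (proj₂ (proj₁ x)) (apex-unique p x)
    (Fill.fill-partition (block I p false) b)

  -- Some split partition from which to compute `default`; by `default-invariant` it does not matter
  -- which.
  side : Elem ((Split ⊕ X ⊙ BC) [ I ]) → ∣ I ∣ → Bool
  side (inj₁ s) = proj₁ (SplitGraph.isSplit s)
  side (inj₂ s) = adj (underlying (inj₂ s)) (apex s)

  side-partition : ∀ s → Partition (underlying s) (side s)
  side-partition (inj₁ s) = split⇒partition {g = SplitGraph.graph s} (proj₂ (SplitGraph.isSplit s))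
  side-partition (inj₂ s) = apex-swing s

  -- The apex is recorded as the one vertex where the chosen partition leaves the default; a bare
  -- split graph gets the default itself.
  standard chosen : Elem ((Split ⊕ X ⊙ BC) [ I ]) → ∣ I ∣ → Bool
  standard s = default (underlying s) (side s)
  chosen (inj₁ s) = standard (inj₁ s)
  chosen (inj₂ s) = flip (apex s) (standard (inj₂ s))

  chosen-partition : ∀ s → Partition (underlying s) (chosen s)
  chosen-partition (inj₁ s) = default-partition (side-partition (inj₁ s))
  chosen-partition (inj₂ s) = flip-partition (side-partition (inj₂ s)) (apex-swing s)

  encode : Elem ((Split ⊕ X ⊙ BC) [ I ]) → Elem (BC [ I ])
  encode s = strip (underlying s) (chosen s)

  -- The apex determines the block function, its neighbours are the green vertices, and the edges
  -- among the base vertices give the filled graph.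
  cone-injective : ∀ s t → apex s ≡ apex t →
    (∀ i j → adj (underlying (inj₂ s)) i j ≡ adj (underlying (inj₂ t)) i j) →
    FinSetoid._≈_ ((X ⊙ BC) [ I ]) s t
  cone-injective s@(p , x , b) t@(q , y , c) v≡w g≈h =
      p≈q , tt
    , (λ i j → sym (fill-injective Q P {c} {b} ρ edges (sym ∘ k≈) i j))
    , isGreen-inj ∘ k≈
    where
    P Q : FinSet
    P = block I p false
    Q = block I q false

    module S = Cone p (Fill.fill P b) (greens b)
    module T = Cone q (Fill.fill Q c) (greens c)

    p≈q : ∀ i → p i ≡ q i
    p≈q i = trans (p-apex p x i) (trans (cong (λ v → does (i ≟ v)) v≡w) (sym (p-apex q y i)))

    ρ : ∣ Q ∣ → ∣ P ∣
    ρ = Inverse.from (restrict (↔-id _) p≈q false)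

    edges : ∀ i j → adj (Fill.fill Q c) i j ≡ adj (Fill.fill P b) (ρ i) (ρ j)
    edges i j = trans (sym (T.cone-base i j)) (trans (sym (g≈h _ _)) (S.cone-base (ρ i) (ρ j)))

    k≈ : ∀ i → greens b (ρ i) ≡ greens c i
    k≈ i = trans (sym (S.cone-apex (proj₂ (proj₁ x)) (ρ i)))
          (trans (g≈h _ _) (trans (cong (λ v → adj T.cone v (proj₁ i)) v≡w)
                 (T.cone-apex (proj₂ (proj₁ y)) i)))

  flip≢ : ∀ v K → flip v K v ≢ K v
  flip≢ v K e = Bool.not-¬ {K v} refl (trans (sym e) (flip-at v K))

  -- `encode s` determines the underlying graph and the chosen partition, and the graph determines
  -- the default. Where the latter two differ reveals the summand and the apex.
  encode-injective : ∀ s t → FinSetoid._≈_ (BC [ I ]) (encode s) (encode t) →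
                     FinSetoid._≈_ ((Split ⊕ X ⊙ BC) [ I ]) s t
  encode-injective s t (e , c) = go s t (proj₁ same) (proj₂ same)
    (default-invariant I I (↔-id _) {underlying s} {underlying t} (proj₁ same) (side-partition s) (side-partition t))
    where
    same : (∀ i j → adj (underlying s) i j ≡ adj (underlying t) i j) × (∀ i → chosen s i ≡ chosen t i)
    same = strip-injective I {underlying s} {underlying t} {chosen s} {chosen t}
             (chosen-partition s) (chosen-partition t) e c

    go : ∀ s t → (∀ i j → adj (underlying s) i j ≡ adj (underlying t) i j) →
         (∀ i → chosen s i ≡ chosen t i) → (∀ i → standard s i ≡ standard t i) →
         FinSetoid._≈_ ((Split ⊕ X ⊙ BC) [ I ]) s t
    go (inj₁ s) (inj₁ t) g≈h K≈L D≈E = inj₁ g≈h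
    go (inj₁ s) (inj₂ t) g≈h K≈L D≈E =
      ⊥-elim (flip≢ (apex t) (standard (inj₂ t)) (trans (sym (K≈L (apex t))) (D≈E (apex t))))
    go (inj₂ s) (inj₁ t) g≈h K≈L D≈E =
      ⊥-elim (flip≢ (apex s) (standard (inj₂ s)) (trans (K≈L (apex s)) (sym (D≈E (apex s)))))
    go (inj₂ s) (inj₂ t) g≈h K≈L D≈E = inj₂ (cone-injective s t v≡w g≈h)
      where
      v≡w : apex s ≡ apex t
      v≡w = decidable-stable (apex s ≟ apex t) λ v≢w → flip≢ (apex s) (standard (inj₂ s))
        (trans (K≈L (apex s)) (trans (flip-off (standard (inj₂ t)) v≢w) (sym (D≈E (apex s)))))

  module _ (b : BicoloredGraph ∣ I ∣) where
    open Fill I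
    private
      g : Graph ∣ I ∣
      g = fill b

      K : ∣ I ∣ → Bool
      K = greens b

    encode-≈ : ∀ s → (∀ i j → adj (underlying s) i j ≡ adj g i j) → (∀ i → chosen s i ≡ K i) →
               FinSetoid._≈_ (BC [ I ]) (encode s) b
    encode-≈ s e k =
        (λ i j → trans (cong₂ _∧_ (e i j) (cong₂ _xor_ (k i) (k j))) (strip-fill b i j))
      , (λ i → isGreen-inj (trans (isGreen-colorOf (chosen s i)) (k i)))

    module Deviating {v : ∣ I ∣} (K≢D : K v ≢ default g K v) where
      p : ∣ I ∣ → Bool
      p i = does (i ≟ v)

      v∈ : p v ≡ true
      v∈ = dec-true (v ≟ v) refl

      unique : ∀ i → p i ≡ true → v ≡ i
      unique i e with i ≟ v
      ... | yes refl = refl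

      -- Since `v` is a swing vertex of `g`, its neighbourhood restricts to a split partition of `g`
      -- without `v`, and stripping along it loses nothing.
      base : BicoloredGraph ∣ block I p false ∣
      base = strip (pull proj₁ g) (adj g v ∘ proj₁)

      s : Elem ((X ⊙ BC) [ I ])
      s = p , ((v , v∈) , λ (j , e) → block-≡ (unique j e)) , base

      underlying-≈ : ∀ i j → adj (underlying (inj₂ s)) i j ≡ adj g i j
      underlying-≈ = Cone.cone-universal p (Fill.fill (block I p false) base) (greens base) v∈ unique {g = g} id
        (λ j → sym (isGreen-colorOf _))
        (λ i j → sym (Fill.fill-strip (block I p false) {pull proj₁ g} {adj g v ∘ proj₁}
          (pull-partition {g = pull proj₁ g} {g} proj₁ proj₁-inj (λ _ _ → refl) (λ _ → refl)
            (deviates⇒swing (fill-partition b) K≢D)) i j))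

      chosen-≈ : ∀ i → chosen (inj₂ s) i ≡ K i
      chosen-≈ i = trans
        -- The default of the cone is computed from the neighbourhood of the apex and that of `g`
        -- from `K`; invariance identifies them.
        (cong (does (i ≟ v) xor_) (default-invariant I I (↔-id _) underlying-≈ (apex-swing s) (fill-partition b) i))
        (deviates⇒flip (fill-partition b) K≢D i)

    -- K differs from the default partition in at most one vertex, which becomes the apex.
    encode-surjective : ∃[ s ] FinSetoid._≈_ (BC [ I ]) (encode s) b
    encode-surjective with search I (λ i → K i Bool.≟ default g K i)
    ... | inj₁ K≡D       = s , encode-≈ s (λ _ _ → refl) (sym ∘ K≡D)
      where
      s : Elem ((Split ⊕ X ⊙ BC) [ I ])
      s = inj₁ record { graph = g ; isSplit = K , partition⇒split {g} (fill-partition b) }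
    ... | inj₂ (v , K≢D) = inj₂ s , encode-≈ (inj₂ s) underlying-≈ chosen-≈
      where open Deviating K≢D

⊙-zeroˡ : ∀ F → 𝟘 ⊙ F ≅ 𝟘
⊙-zeroˡ F = mkIso {𝟘 ⊙ F} {𝟘} (λ I s → proj₁ (proj₂ s)) (λ I ()) (λ I {s} _ → ⊥-elim (proj₁ (proj₂ s)))
  (λ I {s} _ → ⊥-elim s) (λ I ()) (λ I s → ⊥-elim (proj₁ (proj₂ s))) (λ I J φ s → ⊥-elim (proj₁ (proj₂ s)))

-- Equivariance of the encoding

module _ (I J : FinSet) (φ : ∣ I ∣ ↔ ∣ J ∣) where
  private
    module I = Encode I
    module J = Encode J
    module φ = Inverse φ

  apex-equivariant : ∀ {s t} → FinSetoid._≈_ ((X ⊙ BC) [ J ]) (relabel (X ⊙ BC) {I} {J} φ s) t →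
                     φ.to (I.apex s) ≡ J.apex t
  apex-equivariant {p , x , b} {q , y , c} (e , _) = sym (J.apex-unique q y _
    (trans (sym (e _)) (trans (cong p (φ.strictlyInverseʳ _)) (proj₂ (proj₁ x)))))

  underlying-equivariant : ∀ {s t} →
    FinSetoid._≈_ ((Split ⊕ X ⊙ BC) [ J ]) (relabel (Split ⊕ X ⊙ BC) {I} {J} φ s) t →
    ∀ i j → adj (I.underlying s) i j ≡ adj (J.underlying t) (φ.to i) (φ.to j)
  underlying-equivariant {inj₁ s} {inj₁ t} (inj₁ e) i j =
    trans (cong₂ (adj (SplitGraph.graph s)) (sym (φ.strictlyInverseʳ i)) (sym (φ.strictlyInverseʳ j))) (e _ _)
  underlying-equivariant {inj₂ (p , x , b)} {inj₂ (q , y , c)} (inj₂ (e , _ , edges , colors)) =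
    Cone.cone-universal p (Fill.fill P b) (greens b) (proj₂ (proj₁ x)) (I.apex-unique p x)
      {g = J.underlying (inj₂ (q , y , c))} φ.to
      (λ j → trans (Cone.cone-apex q (Fill.fill Q c) (greens c) (ρ-true (proj₁ x)) (ρ.to j)) (sym (k≈ j)))
      (λ i j → trans (Cone.cone-base q (Fill.fill Q c) (greens c) (ρ.to i) (ρ.to j))
        (sym (fill-cong P Q {b} {c} ρ.to (↔-inj ρ) e≈ k≈ i j)))
    where
    P Q : FinSet
    P = block I p false
    Q = block J q false

    ρ-true : (i : ∣ block I p true ∣) → q (φ.to (proj₁ i)) ≡ true
    ρ-true (i , h) = trans (sym (e _)) (trans (cong p (φ.strictlyInverseʳ i)) h)

    ρ : ∣ P ∣ ↔ ∣ Q ∣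
    ρ = restrict φ (λ i → trans (cong p (sym (φ.strictlyInverseʳ i))) (e (φ.to i))) false
    module ρ = Inverse ρ

    e≈ : ∀ i j → edge b i j ≡ edge c (ρ.to i) (ρ.to j)
    e≈ i j = trans (cong₂ (edge b) (block-≡ (sym (φ.strictlyInverseʳ _))) (block-≡ (sym (φ.strictlyInverseʳ _))))
                   (edges (ρ.to i) (ρ.to j))

    k≈ : ∀ i → greens b i ≡ greens c (ρ.to i)
    k≈ i = cong isGreen (trans (cong (BicoloredGraph.color b) (block-≡ (sym (φ.strictlyInverseʳ _)))) (colors (ρ.to i)))

  -- Underlying graph, default partition and apex are all carried along by `φ`, hence so is the flip
  -- at the apex.
  encode-equivariant : ∀ {s t} →
    FinSetoid._≈_ ((Split ⊕ X ⊙ BC) [ J ]) (relabel (Split ⊕ X ⊙ BC) {I} {J} φ s) t →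
    FinSetoid._≈_ (BC [ J ]) (relabel BC {I} {J} φ (I.encode s)) (J.encode t)
  encode-equivariant {s} {t} e = strip-equivariant φ {I.underlying s} {J.underlying t} g≈h (chosen-≈ s t e D≈E)
    where
    g≈h : ∀ i j → adj (I.underlying s) i j ≡ adj (J.underlying t) (φ.to i) (φ.to j)
    g≈h = underlying-equivariant {s} {t} e

    D≈E : ∀ i → I.standard s i ≡ J.standard t (φ.to i)
    D≈E = default-invariant I J φ {I.underlying s} {J.underlying t} g≈h (I.side-partition s) (J.side-partition t)

    chosen-≈ : ∀ s t → FinSetoid._≈_ ((Split ⊕ X ⊙ BC) [ J ]) (relabel (Split ⊕ X ⊙ BC) {I} {J} φ s) t →
      (∀ i → I.standard s i ≡ J.standard t (φ.to i)) → ∀ i → I.chosen s i ≡ J.chosen t (φ.to i)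
    chosen-≈ (inj₁ _) (inj₁ _) _ D≈E = D≈E
    chosen-≈ (inj₂ s) (inj₂ t) (inj₂ e) D≈E i = cong₂ _xor_
      (does-⇔ (mk⇔ (λ i≡v → trans (cong φ.to i≡v) v≡w) (λ i≡w → ↔-inj φ (trans i≡w (sym v≡w))))
              (FinSet._≟_ I i (I.apex s)) (FinSet._≟_ J (φ.to i) (J.apex t)))
      (D≈E i)
      where
      v≡w : φ.to (I.apex s) ≡ J.apex t
      v≡w = apex-equivariant {s} {t} e

-- Combining the recursions

BC-recursion : BC ≅ Split ⊕ X ⊙ BC
BC-recursion = ≅-sym (equivariant-iso (λ I → Encode.encode I) (λ I J φ {s} {t} → encode-equivariant I J φ {s} {t})
  (λ I {s} {t} → Encode.encode-injective I s t) (λ I → Encode.encode-surjective I))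

-- Multiplying `Geometric-unfold` by `Split` on the right turns it into the recursion satisfied by
-- `BC`.
BC≅Geometric⊙Split : BC ≅ Geometric ⊙ Split
BC≅Geometric⊙Split = X-recursion-unique BC-recursion
  (≅-trans (⊙-cong Geometric-unfold ≅-refl)
  (≅-trans (⊙-distribʳ 𝟙 (X ⊙ Geometric) Split)
           (⊕-cong (⊙-identityˡ Split) (⊙-assoc X Geometric Split))))

theorem3p2 : ⟦ BC ⟧ ≈ᵛ 1/ (1ᵛ -ᵛ ⟦ X ⟧) *ᵛ ⟦ Split ⟧
theorem3p2 = ≅-trans lhs (≅-sym rhs)
  where
  open Virtual (1/ (1ᵛ -ᵛ ⟦ X ⟧) *ᵛ ⟦ Split ⟧) renaming (pos to P; neg to N)

  -- The inverse is `⟦ Geometric ⟧`, so `N` is `Geometric ⊙ 𝟘 ⊕ 𝟘 ⊙ Split` and vanishes.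
  lhs : BC ⊕ N ≅ Geometric ⊙ Split
  lhs = ≅-trans (⊕-cong BC≅Geometric⊙Split (≅-trans (⊕-cong (⊙-zeroʳ Geometric) (⊙-zeroˡ Split)) (⊕-identityˡ 𝟘)))
                (⊕-identityʳ (Geometric ⊙ Split))

  rhs : P ⊕ 𝟘 ≅ Geometric ⊙ Split
  rhs = ≅-trans (⊕-identityʳ P) (≅-trans (⊕-cong ≅-refl (⊙-zeroʳ 𝟘)) (⊕-identityʳ (Geometric ⊙ Split)))
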